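{- Let $\mathcal S=e_1,e_2,\ldots$ be a bipartite graph stream, let $M$ be the maximum reservoir size and $\gamma\in(0,1)$ the resampling parameter. For every $t\ge 1$, the estimate $Y^t$ returned by algorithm FLEET1 (with parameters $M,\gamma$) after processing the first $t$ edges satisfies $$\mathbb E[Y^t]=\xi^t,$$ where $\xi^t$ is the number of butterflies in the graph $G^t$ formed by the first $t$ edges.
   Context: Graphs are simple, undirected bipartite graphs with vertex set $L\sqcup R$ and edges in $L\times R$. A butterfly is a subgraph on $a\ne b\in L$, $x\neq y\in R$ with all four edges $(a,x),(a,y),(b,x),(b,y)$ present. A graph stream is a sequence $e_1,e_2,\ldots$ of distinct edges in arbitrary fixed order; $G^t$ is the graph with edge set $\{e_1,\ldots,e_t\}$ and $\xi^t$ is its number of butterflies. For an edge set $\mathcal R$, $\xi(\mathcal R)$ denotes the number of butterflies in the graph induced by $\mathcal R$. Algorithm FLEET1 with parameters $M$ (positive integer) and $\gamma\in(0,1)$: initialize $p\leftarrow 1$, reservoir $\mathcal R\leftarrow\emptyset$, $\beta\leftarrow 0$. On arrival of each edge $e=e_t$: (1) while $|\mathcal R|\ge M$: set $p\leftarrow\gamma p$; independently for each edge of $\mathcal R$, keep it in $\mathcal R$ with probability $\gamma$ and discard it with probability $1-\gamma$; set $\beta\leftarrow p^{ -4}\,\xi(\mathcal R)$. (2) With probability $p$ (an independent coin), set $\mathcal R\leftarrow\mathcal R\cup\{e\}$ and $\beta\leftarrow\beta+p^{ -4}\cdot b$, where $b$ is the number of butterflies containing $e$ in the graph induced by $\mathcal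 R$. (3) Set $Y^t\leftarrow\beta$. All random choices are mutually independent; expectation is over these choices only.
   Formalization: The reservoir size is required to satisfy M ≥ 5: for M ≤ 4 the claim fails (four butterfly edges followed by a disjoint fifth edge give Y^5 = 0 but ξ^5 = 1). -}

module Defs where

open import Algebra.Apartness.Bundles using (HeytingField; HeytingCommutativeRing)
import Algebra.Apartness.Properties.HeytingCommutativeRing as HeytingProperties
open import Algebra.Bundles using (CommutativeRing; Semiring)
import Algebra.Definitions.RawMonoid as RawMonoidDefs
import Algebra.Definitions.RawSemiring as RawSemiringDefs
import Algebra.Properties.Ring as RingProperties
open import Data.Bool.Base using (Bool; true; false; if_then_else_)
open import Data.List.Base using (List; []; _∷_; _++_; map; foldr; filter; length; take)
open import Data.List.Membership.Propositional using (_∈_; find; lose)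
open import Data.List.Membership.Propositional.Properties using (∈-∃++)
import Data.List.Membership.DecPropositional as DecMembership
open import Data.List.Relation.Binary.Permutation.Propositional
  using (_↭_; ↭-refl; ↭-sym; ↭-trans; prep)
open import Data.List.Relation.Binary.Permutation.Propositional.Properties
  using (shift; drop-mid; ∈-resp-↭; ↭-empty-inv; ¬x∷xs↭[])
open import Data.List.Relation.Binary.Subset.Propositional using (_⊆_)
open import Data.List.Relation.Unary.Any using (Any; here; there; any?)
open import Data.List.Relation.Unary.Unique.Propositional using (Unique)
open import Data.Nat.Base using (ℕ; zero; suc) renaming (_≤_ to _≤ₙ_)
open import Data.Nat.Properties using (_≤?_)
open import Data.Product.Base using (Σ; ∃-syntax; _×_; _,_; proj₁; proj₂)
open import Data.Product.Properties using (≡-dec)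
open import Data.Sum.Base using (_⊎_; inj₁; inj₂)
open import Data.Unit.Base using (⊤)
open import Level using (Level; _⊔_) renaming (zero to 0ℓ; suc to lsuc)
open import Relation.Binary.Core using (Rel)
open import Relation.Binary.Definitions using (DecidableEquality)
open import Relation.Binary.PropositionalEquality using (_≡_; _≢_; refl)
open import Relation.Binary.Structures using (IsStrictPartialOrder)
open import Relation.Nullary.Decidable using (Dec; yes; no; ¬?; _×-dec_; map′; True; False)
open import Relation.Unary using (Pred; Decidable)

-- The real numbers enter only through the following axioms, which hold for ℝ
-- both classically and constructively.  Cauchy completeness is not among them:
-- the only limits ever asserted below are given explicitly.

record ArchimedeanOrderedField (c ℓ₁ ℓ₂ ℓ₃ : Level) : Set (lsuc (c ⊔ ℓ₁ ⊔ ℓ₂ ⊔ ℓ₃)) where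
  field
    heytingField : HeytingField c ℓ₁ ℓ₂

  open HeytingField heytingField public

  open HeytingCommutativeRing heytingCommutativeRing public
    using (commutativeRing)
  open CommutativeRing commutativeRing public
    using (ring; semiring; +-rawMonoid)

  open RawMonoidDefs +-rawMonoid public using () renaming (_×_ to _·_)
  open RawSemiringDefs (Semiring.rawSemiring semiring) public using (_^_)

  infix 4 _<_
  field
    _<_                  : Rel Carrier ℓ₃
    isStrictPartialOrder : IsStrictPartialOrder _≈_ _<_
    <⇒#                  : ∀ {x y} → x < y → x # y
    #⇒<⊎>                : ∀ {x y} → x # y → x < y ⊎ y < x
    +-monoˡ-<            : ∀ z {x y} → x < y → x + z < y + z
    *-pos                : ∀ {x y} → 0# < x → 0# < y → 0# < x * y
    archimedean          : ∀ x → ∃[ n ] x < n · 1#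

  fromℕ : ℕ → Carrier
  fromℕ n = n · 1#

  0<1 : 0# < 1#
  0<1 with #⇒<⊎> (HeytingProperties.1#0 heytingCommutativeRing)
  ... | inj₂ 0<1# = 0<1#
  ... | inj₁ 1<0  = <-respʳ-≈ -1*-1≈1 (*-pos 0<-1 0<-1)
    where
    open IsStrictPartialOrder isStrictPartialOrder using (<-respˡ-≈; <-respʳ-≈)
    open RingProperties ring using (-1*x≈-x; -‿involutive)

    0<-1 : 0# < - 1#
    0<-1 = <-respˡ-≈ (-‿inverseʳ 1#) (<-respʳ-≈ (+-identityˡ (- 1#)) (+-monoˡ-< (- 1#) 1<0))

    -1*-1≈1 : - 1# * - 1# ≈ 1#
    -1*-1≈1 = trans (-1*x≈-x (- 1#)) (-‿involutive 1#)

  -- `#⇒invertible` inverts x - 0#, which is ≈ x.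
  inv : ∀ x → 0# < x → Carrier
  inv x x>0 = proj₁ (#⇒invertible (#-sym (<⇒# x>0)))

module Probability {c ℓ₁ ℓ₂ ℓ₃ : Level} (K : ArchimedeanOrderedField c ℓ₁ ℓ₂ ℓ₃) where

  open ArchimedeanOrderedField K

  sumOver : {A : Set} → (A → Carrier) → List A → Carrier
  sumOver f xs = foldr _+_ 0# (map f xs)

  -- Unconditional summation of a family over an arbitrary index type: the
  -- sums over finite subsets converge to s along the inclusion order.
  HasSum : {A : Set} → (A → Carrier) → Carrier → Set (c ⊔ ℓ₃)
  HasSum {A} f s =
    ∀ ε → 0# < ε →
    ∃[ xs ] ∀ (ys : List A) → Unique ys → xs ⊆ ys →
      (s - ε < sumOver f ys) × (sumOver f ys < s + ε)

  -- A random variable on a discrete sample space.  The total mass is not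
  -- required to be 1 here, since a while loop may fail to terminate with
  -- positive probability; `HasExpectation` requires it.
  record Dist {a : Level} (A : Set a) : Set (lsuc 0ℓ ⊔ a ⊔ c) where
    field
      Ω   : Set
      ℙ   : Ω → Carrier
      val : Ω → A

  open Dist public

  HasExpectation : Dist Carrier → Carrier → Set (c ⊔ ℓ₃)
  HasExpectation X μ = HasSum (ℙ X) 1# × HasSum (λ ω → ℙ X ω * val X ω) μ

  private
    variable
      a b p : Level
      A : Set a
      B : Set b

  return : A → Dist A
  return x .Ω     = ⊤
  return x .ℙ _   = 1#
  return x .val _ = x

  -- Each use of randomness contributes its own factor to the sample space, so
  -- distinct random choices are mutually independent.
  infixl 1 _>>=_
  _>>=_ : Dist A → (A → Dist B) → Dist B
  (X >>= f) .Ω             = Σ (Ω X) λ ω → Ω (f (val X ω))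
  (X >>= f) .ℙ   (ω , ω′) = ℙ X ω * ℙ (f (val X ω)) ω′
  (X >>= f) .val (ω , ω′) = val (f (val X ω)) ω′

  bernoulli : Carrier → Dist Bool
  bernoulli q .Ω       = Bool
  bernoulli q .ℙ true  = q
  bernoulli q .ℙ false = 1# - q
  bernoulli q .val x   = x

  module _ {C : Pred A p} (C? : Decidable C) (body : A → Dist A) where

    -- The executions of `while C do body` with exactly n iterations.
    iterations : ℕ → A → Dist A
    iterations zero x .Ω     = False (C? x)
    iterations zero x .ℙ _   = 1#
    iterations zero x .val _ = x
    iterations (suc n) x .Ω             = True (C? x) × Ω (body x >>= iterations n)
    iterations (suc n) x .ℙ   (_ , ω) = ℙ (body x >>= iterations n) ω
    iterations (suc n) x .val (_ , ω) = val (body x >>= iterations n) ω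

    -- The sample space consists of the terminating executions.
    while : A → Dist A
    while x .Ω             = Σ ℕ λ n → Ω (iterations n x)
    while x .ℙ   (n , ω) = ℙ (iterations n x) ω
    while x .val (n , ω) = val (iterations n x) ω

sublists : {A : Set} → List A → List (List A)
sublists []       = [] ∷ []
sublists (x ∷ xs) = map (x ∷_) (sublists xs) ++ sublists xs

module DecPermutation {A : Set} (_≟_ : DecidableEquality A) where

  open DecMembership _≟_ using (_∈?_)

  _↭?_ : (xs ys : List A) → Dec (xs ↭ ys)
  []       ↭? []       = yes ↭-refl
  []       ↭? (y ∷ ys) = no λ r → ¬x∷xs↭[] (↭-sym r)
  (x ∷ xs) ↭? ys with x ∈? ys
  ... | no x∉ys = no λ r → x∉ys (∈-resp-↭ r (here refl))
  ... | yes x∈ys with ∈-∃++ x∈ys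
  ...   | us , vs , refl =
    map′ (λ r → ↭-trans (prep x r) (↭-sym (shift x us vs)))
         (drop-mid [] us)
         (xs ↭? (us ++ vs))

module Butterflies {L R : Set} (_≟ᴸ_ : DecidableEquality L) (_≟ᴿ_ : DecidableEquality R) where

  Edge : Set
  Edge = L × R

  _≟_ : DecidableEquality Edge
  _≟_ = ≡-dec _≟ᴸ_ _≟ᴿ_

  open DecMembership _≟_ using (_∈?_)
  open DecPermutation _≟_ using (_↭?_)

  square : L → L → R → R → List Edge
  square a b x y = (a , x) ∷ (a , y) ∷ (b , x) ∷ (b , y) ∷ []

  IsButterfly : List Edge → Set
  IsButterfly B =
    ∃[ a ] ∃[ b ] ∃[ x ] ∃[ y ] a ≢ b × x ≢ y × B ↭ square a b x y

  -- The vertices of a butterfly can be read off two of its edges that do not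
  -- share an endpoint.
  isButterfly? : Decidable IsButterfly
  isButterfly? B = map′ to from (any? (λ e → any? (opposite? e) B) B)
    where
    Opposite : Edge → Edge → Set
    Opposite (a , x) (b , y) = a ≢ b × x ≢ y × B ↭ square a b x y

    opposite? : ∀ e → Decidable (Opposite e)
    opposite? (a , x) (b , y) =
      ¬? (a ≟ᴸ b) ×-dec ¬? (x ≟ᴿ y) ×-dec (B ↭? square a b x y)

    to : Any (λ e → Any (Opposite e) B) B → IsButterfly B
    to h with find h
    ... | (a , x) , _ , h′ with find h′
    ...   | (b , y) , _ , q = a , b , x , y , q

    from : IsButterfly B → Any (λ e → Any (Opposite e) B) B
    from (a , b , x , y , q@(_ , _ , r)) =
      lose (∈-resp-↭ (↭-sym r) (here refl))
           (lose (∈-resp-↭ (↭-sym r) (there (there (there (here refl))))) q)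

  -- A graph is given by a duplicate-free list of its edges, and a subgraph by
  -- its edge set.  The sublists of a duplicate-free list
  -- represent each of its subsets once.
  butterflies : List Edge → List (List Edge)
  butterflies G = filter isButterfly? (sublists G)

  ξ : List Edge → ℕ
  ξ G = length (butterflies G)

  ξ-containing : Edge → List Edge → ℕ
  ξ-containing e G = length (filter (e ∈?_) (butterflies G))

module FLEET1
  {c ℓ₁ ℓ₂ ℓ₃ : Level} (K : ArchimedeanOrderedField c ℓ₁ ℓ₂ ℓ₃)
  {L R : Set} (_≟ᴸ_ : DecidableEquality L) (_≟ᴿ_ : DecidableEquality R)
  (M : ℕ)
  (γ : ArchimedeanOrderedField.Carrier K)
  (γ>0 : ArchimedeanOrderedField._<_ K (ArchimedeanOrderedField.0# K) γ)
  where

  open ArchimedeanOrderedField K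
  open Probability K
  open Butterflies _≟ᴸ_ _≟ᴿ_

  record State : Set (c ⊔ ℓ₃) where
    field
      p   : Carrier
      p>0 : 0# < p
      𝓡   : List Edge
      β   : Carrier

    p⁻⁴ : Carrier
    p⁻⁴ = inv p p>0 ^ 4

  open State

  initial : State
  initial = record { p = 1# ; p>0 = 0<1 ; 𝓡 = [] ; β = 0# }

  subsample : List Edge → Dist (List Edge)
  subsample []      = return []
  subsample (e ∷ G) = do
    keep ← bernoulli γ
    G′   ← subsample G
    return (if keep then e ∷ G′ else G′)

  resample : State → Dist State
  resample s = do
    𝓡′ ← subsample (𝓡 s)
    let p′   = γ * p s
        p′>0 = *-pos γ>0 (p>0 s)
    return record { p = p′ ; p>0 = p′>0 ; 𝓡 = 𝓡′ ; β = inv p′ p′>0 ^ 4 * fromℕ (ξ 𝓡′) }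

  Full : State → Set
  Full s = M ≤ₙ length (𝓡 s)

  full? : Decidable Full
  full? s = M ≤? length (𝓡 s)

  insert : Edge → State → State
  insert e s = record s
    { 𝓡 = e ∷ 𝓡 s
    ; β = β s + p⁻⁴ s * fromℕ (ξ-containing e (e ∷ 𝓡 s))
    }

  arrive : Edge → State → Dist State
  arrive e s = do
    s′   ← while full? resample s
    coin ← bernoulli (p s′)
    return (if coin then insert e s′ else s′)

  process : List Edge → State → Dist State
  process []       s = return s
  process (e ∷ es) s = arrive e s >>= process es

  Y : List Edge → ℕ → Dist Carrier
  Y S t = do
    s ← process (take t S) initial
    return (β s)

{-# OPTIONS --safe #-}

-- Write q = 1/p.  A butterfly is an edge set of size 4, and for every edge set B of size at most 4
-- the variable q^|B ∩ E_t| [B ∩ E_t ⊆ 𝓡], where E_t is the set of edges seen so far, is a martingale: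
-- resampling multiplies q by 1/γ and keeps B ∩ E_t with probability γ^|B ∩ E_t|, and a new edge of B
-- is kept with probability p.  Summing over the butterflies gives 𝔼[Y^t] = ξ^t, because β is always
-- q⁴ ξ(𝓡).  The while loop, which may run arbitrarily long, is where M ≥ 5 enters: while it runs, 𝓡
-- has an edge outside B, which has survived every iteration, so an execution with more than n
-- iterations contributes at most |𝓡| γⁿ times the initial value.  The case B = ∅ shows that the loop
-- terminates almost surely.
--
-- All sums are over nonnegative terms.  The countable sample space is exhausted by finite stages,
-- allowing at most n iterations of each loop in stage n; the n-th partial sum is then at most the
-- claimed value and misses at most C γⁿ of it.

module Submission where

open import Defs
open import Algebra.Bundles using (CommutativeRing)
import Algebra.Apartness.Properties.HeytingCommutativeRing as HeytingProperties
open import Data.Bool.Base using (Bool; true; false; T; if_then_else_)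
open import Data.List.Base using (List; []; _∷_; _++_; map; concatMap; filter; length; take; upTo; applyUpTo)
import Data.List.Properties as List
import Data.List.Membership.DecPropositional as DecMembership
open import Data.List.Membership.Propositional using (_∈_; _∉_; find)
open import Data.List.Membership.Propositional.Properties
  using (∈-∃++; ∈-concatMap⁺; ∈-concatMap⁻; ∈-map⁺; ∈-map⁻; ∈-upTo⁺; ∈-upTo⁻; ∈-++⁻; ∈-++⁺ˡ; ∈-++⁺ʳ)
open import Data.List.Relation.Binary.Disjoint.Propositional using (Disjoint)
open import Data.List.Relation.Binary.Permutation.Propositional using (_↭_; ↭-sym; ↭-trans)
open import Data.List.Relation.Binary.Permutation.Propositional.Properties using (shift; ↭-length; ¬x∷xs↭[])
open import Data.List.Relation.Binary.Subset.Propositional using (_⊆_)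
open import Data.List.Relation.Unary.All as All using (All; []; _∷_)
import Data.List.Relation.Unary.All.Properties as All
open import Data.List.Relation.Unary.AllPairs as AllPairs using ([]; _∷_)
import Data.List.Relation.Unary.AllPairs.Properties as AllPairs
open import Data.List.Relation.Unary.Any as Any using (here; there)
open import Data.List.Relation.Unary.Unique.Propositional using (Unique)
import Data.List.Relation.Unary.Unique.Propositional.Properties as Unique
open import Data.Nat.Base as ℕ using (ℕ; zero; suc; _≤_; z≤n; s≤s)
import Data.Nat.Properties as ℕ
open import Data.Product.Base using (Σ; ∃-syntax; _×_; _,_; proj₁; proj₂)
open import Data.Sum.Base using (inj₁; inj₂)
open import Data.Unit.Base using (⊤; tt)
open import Function.Base using (_∘_; id)
open import Level as Level using (Level)
open import Relation.Binary.Definitions using (DecidableEquality)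
import Relation.Binary.Construct.StrictToNonStrict as ToNonStrict
import Relation.Binary.Reasoning.Base.Triple as TripleReasoning
open import Relation.Binary.PropositionalEquality as ≡ using (_≡_; _≢_)
open import Relation.Binary.Structures using (IsStrictPartialOrder)
open import Relation.Nullary.Decidable using (Dec; yes; no)
open import Relation.Nullary.Negation using (¬_; contradiction)
open import Relation.Unary using (Pred; Decidable)

-- Order, inverses and geometric decay in an Archimedean ordered field

module OrderedFieldProperties
  {c ℓ₁ ℓ₂ ℓ₃ : Level} (K : ArchimedeanOrderedField c ℓ₁ ℓ₂ ℓ₃) where

  open ArchimedeanOrderedField K
  open CommutativeRing commutativeRing public using (commutativeSemiring)
  open IsStrictPartialOrder isStrictPartialOrder public
    using (<-respˡ-≈; <-respʳ-≈; <-resp-≈)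
    renaming (trans to <-trans; irrefl to <-irrefl; asym to <-asym)
  open HeytingProperties heytingCommutativeRing using (x-0≈x; invertibleˡ⇒#)
  open import Algebra.Solver.Ring.NaturalCoefficients.Default commutativeSemiring public
    using (solve; _:=_; _:+_; _:*_; con)

  module Order = ToNonStrict _≈_ _<_

  infix 4 _≼_
  -- Constructively this disjunction is stronger than the negation of `y < x`. It is available
  -- throughout because every estimate is assembled from explicit strict inequalities and
  -- equalities, and it provides the case split on the multiplier in `*-monoʳ-≼`.
  _≼_ : Carrier → Carrier → Set _
  _≼_ = Order._≤_

  ≼-reflexive : ∀ {x y} → x ≈ y → x ≼ y
  ≼-reflexive = inj₂

  ≼-refl : ∀ {x} → x ≼ x
  ≼-refl = inj₂ refl

  ≼-trans : ∀ {x y z} → x ≼ y → y ≼ z → x ≼ z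
  ≼-trans = Order.trans isEquivalence <-resp-≈ <-trans

  module ≼-Reasoning = TripleReasoning
    (Order.isPreorder₂ isStrictPartialOrder) <-asym <-trans <-resp-≈ Order.<⇒≤
    (Order.<-≤-trans <-trans <-respʳ-≈) (Order.≤-<-trans sym <-trans <-respˡ-≈)

  open ≼-Reasoning

  +-monoʳ-< : ∀ z {x y} → x < y → z + x < z + y
  +-monoʳ-< z x<y = <-respˡ-≈ (+-comm _ z) (<-respʳ-≈ (+-comm _ z) (+-monoˡ-< z x<y))

  +-monoˡ-≼ : ∀ z {x y} → x ≼ y → x + z ≼ y + z
  +-monoˡ-≼ z (inj₁ x<y) = inj₁ (+-monoˡ-< z x<y)
  +-monoˡ-≼ z (inj₂ x≈y) = inj₂ (+-congʳ x≈y)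

  +-mono-≼ : ∀ {x y u v} → x ≼ y → u ≼ v → x + u ≼ y + v
  +-mono-≼ {x} {y} {u} {v} x≼y u≼v = begin
    x + u  ≤⟨ +-monoˡ-≼ u x≼y ⟩
    y + u  ≈⟨ +-comm y u ⟩
    u + y  ≤⟨ +-monoˡ-≼ y u≼v ⟩
    v + y  ≈⟨ +-comm v y ⟩
    y + v  ∎

  +-monoʳ-≼ : ∀ z {x y} → x ≼ y → z + x ≼ z + y
  +-monoʳ-≼ z = +-mono-≼ ≼-refl

  0≼x+y : ∀ {x y} → 0# ≼ x → 0# ≼ y → 0# ≼ x + y
  0≼x+y 0≼x 0≼y = ≼-trans (≼-reflexive (sym (+-identityˡ 0#))) (+-mono-≼ 0≼x 0≼y)

  x≼y+x : ∀ {x y} → 0# ≼ y → x ≼ y + x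
  x≼y+x {x} 0≼y = ≼-trans (≼-reflexive (sym (+-identityˡ x))) (+-monoˡ-≼ x 0≼y)

  x≼x+y : ∀ {x y} → 0# ≼ y → x ≼ x + y
  x≼x+y {x} 0≼y = ≼-trans (x≼y+x 0≼y) (≼-reflexive (+-comm _ x))

  y-x+x≈y : ∀ x y → (y - x) + x ≈ y
  y-x+x≈y x y = trans (+-assoc y (- x) x) (trans (+-congˡ (-‿inverseˡ x)) (+-identityʳ y))

  x<y⇒0<y-x : ∀ {x y} → x < y → 0# < y - x
  x<y⇒0<y-x {x} x<y = <-respˡ-≈ (-‿inverseʳ x) (+-monoˡ-< (- x) x<y)

  x≼y⇒0≼y-x : ∀ {x y} → x ≼ y → 0# ≼ y - x
  x≼y⇒0≼y-x {x} x≼y = ≼-trans (≼-reflexive (sym (-‿inverseʳ x))) (+-monoˡ-≼ (- x) x≼y)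

  x<y+z⇒x-z<y : ∀ {x y z} → x < y + z → x - z < y
  x<y+z⇒x-z<y {x} {y} {z} x<y+z =
    <-respʳ-≈ (trans (+-assoc y z (- z)) (trans (+-congˡ (-‿inverseʳ z)) (+-identityʳ y)))
              (+-monoˡ-< (- z) x<y+z)

  *-monoʳ-< : ∀ {z x y} → 0# < z → x < y → z * x < z * y
  *-monoʳ-< {z} {x} {y} 0<z x<y = begin-strict
    z * x                  ≈⟨ +-identityˡ (z * x) ⟨
    0# + z * x             <⟨ +-monoˡ-< (z * x) (*-pos 0<z (x<y⇒0<y-x x<y)) ⟩
    z * (y - x) + z * x    ≈⟨ distribˡ z (y - x) x ⟨
    z * ((y - x) + x)      ≈⟨ *-congˡ (y-x+x≈y x y) ⟩
    z * y                  ∎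

  *-monoʳ-≼ : ∀ {z x y} → 0# ≼ z → x ≼ y → z * x ≼ z * y
  *-monoʳ-≼ (inj₁ 0<z) (inj₁ x<y) = inj₁ (*-monoʳ-< 0<z x<y)
  *-monoʳ-≼ (inj₁ 0<z) (inj₂ x≈y) = inj₂ (*-congˡ x≈y)
  *-monoʳ-≼ {z} {x} {y} (inj₂ 0≈z) _ = inj₂ (begin-equality
    z * x   ≈⟨ *-congʳ 0≈z ⟨
    0# * x  ≈⟨ zeroˡ x ⟩
    0#      ≈⟨ zeroˡ y ⟨
    0# * y  ≈⟨ *-congʳ 0≈z ⟩
    z * y   ∎)

  *-monoˡ-≼ : ∀ {z x y} → 0# ≼ z → x ≼ y → x * z ≼ y * z
  *-monoˡ-≼ {z} {x} {y} 0≼z x≼y = begin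
    x * z  ≈⟨ *-comm x z ⟩
    z * x  ≤⟨ *-monoʳ-≼ 0≼z x≼y ⟩
    z * y  ≈⟨ *-comm z y ⟩
    y * z  ∎

  0≼x*y : ∀ {x y} → 0# ≼ x → 0# ≼ y → 0# ≼ x * y
  0≼x*y {x} 0≼x 0≼y = ≼-trans (≼-reflexive (sym (zeroʳ x))) (*-monoʳ-≼ 0≼x 0≼y)

  0≼1 : 0# ≼ 1#
  0≼1 = inj₁ 0<1

  0≼fromℕ : ∀ n → 0# ≼ fromℕ n
  0≼fromℕ zero    = ≼-refl
  0≼fromℕ (suc n) = 0≼x+y 0≼1 (0≼fromℕ n)

  fromℕ-mono : ∀ {m n} → m ≤ n → fromℕ m ≼ fromℕ n
  fromℕ-mono {n = n} z≤n = 0≼fromℕ n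
  fromℕ-mono (s≤s m≤n)   = +-monoʳ-≼ 1# (fromℕ-mono m≤n)

  0<^ : ∀ {x} n → 0# < x → 0# < x ^ n
  0<^ zero    0<x = 0<1
  0<^ (suc n) 0<x = *-pos 0<x (0<^ n 0<x)

  ^-distrib-* : ∀ x y n → (x * y) ^ n ≈ x ^ n * y ^ n
  ^-distrib-* x y zero    = sym (*-identityˡ 1#)
  ^-distrib-* x y (suc n) = begin-equality
    x * y * (x * y) ^ n        ≈⟨ *-congˡ (^-distrib-* x y n) ⟩
    x * y * (x ^ n * y ^ n)    ≈⟨ solve 4 (λ a b c d → a :* b :* (c :* d) := a :* c :* (b :* d)) refl x y (x ^ n) (y ^ n) ⟩
    x * x ^ n * (y * y ^ n)    ∎

  ^-congˡ : ∀ {x y} n → x ≈ y → x ^ n ≈ y ^ n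
  ^-congˡ zero    x≈y = refl
  ^-congˡ (suc n) x≈y = *-cong x≈y (^-congˡ n x≈y)

  *-invʳ : ∀ {x} (x>0 : 0# < x) → x * inv x x>0 ≈ 1#
  *-invʳ {x} x>0 = trans (*-congʳ (sym (x-0≈x x))) (proj₂ (proj₂ (#⇒invertible (#-sym (<⇒# x>0)))))

  inv-unique : ∀ {x y} (x>0 : 0# < x) → x * y ≈ 1# → y ≈ inv x x>0
  inv-unique {x} {y} x>0 x*y≈1 = begin-equality
    y              ≈⟨ *-identityʳ y ⟨
    y * 1#         ≈⟨ *-congˡ (*-invʳ x>0) ⟨
    y * (x * i)    ≈⟨ solve 3 (λ x y i → y :* (x :* i) := x :* y :* i) refl x y i ⟩
    x * y * i      ≈⟨ *-congʳ x*y≈1 ⟩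
    1# * i         ≈⟨ *-identityˡ i ⟩
    i              ∎
    where i = inv x x>0

  -- An invertible element is apart from zero and so has a sign. A negative inverse would make its
  -- product with `x`, which is one, negative.
  inv>0 : ∀ {x} (x>0 : 0# < x) → 0# < inv x x>0
  inv>0 {x} x>0 with #⇒<⊎> i#0
    where
    i = inv x x>0
    i#0 : i # 0#
    i#0 = invertibleˡ⇒# (x , trans (*-congˡ (x-0≈x i)) (*-invʳ x>0))
  ... | inj₂ 0<i = 0<i
  ... | inj₁ i<0 = contradiction
    (<-trans (<-respˡ-≈ (*-invʳ x>0) (<-respʳ-≈ (zeroʳ x) (*-monoʳ-< x>0 i<0))) 0<1)
    (<-irrefl refl)

  ^≼1 : ∀ {x} n → 0# ≼ x → x ≼ 1# → x ^ n ≼ 1#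
  ^≼1 zero    0≼x x≼1 = ≼-refl
  ^≼1 {x} (suc n) 0≼x x≼1 = begin
    x * x ^ n  ≤⟨ *-monoʳ-≼ 0≼x (^≼1 n 0≼x x≼1) ⟩
    x * 1#     ≈⟨ *-identityʳ x ⟩
    x          ≤⟨ x≼1 ⟩
    1#         ∎

  -- Bernoulli's inequality (1 + nδ) γⁿ ≤ 1 for γ = 1 - δ.
  bernoulli-ineq : ∀ {γ} → 0# ≼ γ → γ ≼ 1# → ∀ n → γ ^ n * (fromℕ n * (1# - γ)) + γ ^ n ≼ 1#
  bernoulli-ineq {γ} 0≼γ γ≼1 zero = ≼-reflexive (begin-equality
    1# * (0# * (1# - γ)) + 1#  ≈⟨ +-congʳ (trans (*-congˡ (zeroˡ _)) (zeroʳ 1#)) ⟩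
    0# + 1#                    ≈⟨ +-identityˡ 1# ⟩
    1#                         ∎)
  bernoulli-ineq {γ} 0≼γ γ≼1 (suc n) = begin
    γ * g * ((1# + m) * δ) + γ * g
      ≈⟨ solve 4 (λ c g m d → c :* g :* ((con 1 :+ m) :* d) :+ c :* g := c :* (g :* (m :* d) :+ g) :+ (c :* g) :* d) refl γ g m δ ⟩
    γ * (g * (m * δ) + g) + γ * g * δ
      ≤⟨ +-mono-≼ (*-monoʳ-≼ 0≼γ (bernoulli-ineq 0≼γ γ≼1 n)) (*-monoˡ-≼ (x≼y⇒0≼y-x γ≼1) (^≼1 (suc n) 0≼γ γ≼1)) ⟩
    γ * 1# + 1# * δ  ≈⟨ +-cong (*-identityʳ γ) (*-identityˡ δ) ⟩
    γ + δ            ≈⟨ trans (+-comm γ δ) (y-x+x≈y γ 1#) ⟩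
    1#               ∎
    where
    g = γ ^ n
    m = fromℕ n
    δ = 1# - γ

  -- With δ = 1 - γ, the Archimedean property supplies n > C / (εδ). Then C γⁿ < ε (n δ γⁿ), and
  -- Bernoulli's inequality bounds the bracket by 1.
  geometric-vanishes : ∀ {γ} → 0# < γ → γ < 1# → ∀ C ε → 0# < ε → ∃[ n ] C * γ ^ n < ε
  geometric-vanishes {γ} 0<γ γ<1 C ε 0<ε with archimedean (C * inv _ (*-pos 0<ε (x<y⇒0<y-x γ<1)))
  ... | n , C/εδ<n = n , (begin-strict
    C * g                      ≈⟨ *-identityˡ _ ⟨
    1# * (C * g)               ≈⟨ *-congʳ (*-invʳ εδ>0) ⟨
    ε * δ * i * (C * g)        ≈⟨ solve 5 (λ e d i c g → e :* d :* i :* (c :* g) := g :* e :* d :* (c :* i)) refl ε δ i C g ⟩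
    g * ε * δ * (C * i)        <⟨ *-monoʳ-< (*-pos (*-pos (0<^ n 0<γ) 0<ε) δ>0) C/εδ<n ⟩
    g * ε * δ * m              ≈⟨ solve 4 (λ g e d m → g :* e :* d :* m := e :* (g :* (m :* d))) refl g ε δ m ⟩
    ε * (g * (m * δ))          ≤⟨ *-monoʳ-≼ (inj₁ 0<ε) (x≼x+y (inj₁ (0<^ n 0<γ))) ⟩
    ε * (g * (m * δ) + g)      ≤⟨ *-monoʳ-≼ (inj₁ 0<ε) (bernoulli-ineq (inj₁ 0<γ) (inj₁ γ<1) n) ⟩
    ε * 1#                     ≈⟨ *-identityʳ ε ⟩
    ε                          ∎)
    where
    g = γ ^ n
    m = fromℕ n
    δ = 1# - γ
    δ>0 = x<y⇒0<y-x γ<1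
    εδ>0 = *-pos 0<ε δ>0
    i = inv (ε * δ) εδ>0

-- Finite sums over lists

module FiniteSums
  {c ℓ₁ ℓ₂ ℓ₃ : Level} (K : ArchimedeanOrderedField c ℓ₁ ℓ₂ ℓ₃) where

  open ArchimedeanOrderedField K
  open Probability K using (sumOver)
  open OrderedFieldProperties K
  open ≼-Reasoning

  private
    variable
      A B : Set

  sum-cong : {f g : A → Carrier} → (∀ x → f x ≈ g x) → ∀ xs → sumOver f xs ≈ sumOver g xs
  sum-cong f≈g []       = refl
  sum-cong f≈g (x ∷ xs) = +-cong (f≈g x) (sum-cong f≈g xs)

  sum-mono : {f g : A → Carrier} → (∀ x → f x ≼ g x) → ∀ xs → sumOver f xs ≼ sumOver g xs
  sum-mono f≼g []       = ≼-refl
  sum-mono f≼g (x ∷ xs) = +-mono-≼ (f≼g x) (sum-mono f≼g xs)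

  sum-nonneg : {f : A → Carrier} → (∀ x → 0# ≼ f x) → ∀ xs → 0# ≼ sumOver f xs
  sum-nonneg 0≼f []       = ≼-refl
  sum-nonneg 0≼f (x ∷ xs) = 0≼x+y (0≼f x) (sum-nonneg 0≼f xs)

  sum-zero : {f : A → Carrier} → (∀ x → f x ≈ 0#) → ∀ xs → sumOver f xs ≈ 0#
  sum-zero f≈0 []       = refl
  sum-zero f≈0 (x ∷ xs) = trans (+-cong (f≈0 x) (sum-zero f≈0 xs)) (+-identityˡ 0#)

  sum-+ : (f g : A → Carrier) → ∀ xs → sumOver (λ x → f x + g x) xs ≈ sumOver f xs + sumOver g xs
  sum-+ f g []       = sym (+-identityˡ 0#)
  sum-+ f g (x ∷ xs) = trans (+-congˡ (sum-+ f g xs))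
    (solve 4 (λ a b c d → a :+ b :+ (c :+ d) := a :+ c :+ (b :+ d)) refl
      (f x) (g x) (sumOver f xs) (sumOver g xs))

  sum-*ˡ : ∀ c (f : A → Carrier) xs → sumOver (λ x → c * f x) xs ≈ c * sumOver f xs
  sum-*ˡ c f []       = sym (zeroʳ c)
  sum-*ˡ c f (x ∷ xs) = trans (+-congˡ (sum-*ˡ c f xs)) (sym (distribˡ c (f x) (sumOver f xs)))

  sum-++ : (f : A → Carrier) → ∀ xs ys → sumOver f (xs ++ ys) ≈ sumOver f xs + sumOver f ys
  sum-++ f []       ys = sym (+-identityˡ _)
  sum-++ f (x ∷ xs) ys = trans (+-congˡ (sum-++ f xs ys)) (sym (+-assoc _ _ _))

  sum-map : (f : B → Carrier) (h : A → B) → ∀ xs → sumOver f (map h xs) ≈ sumOver (f ∘ h) xs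
  sum-map f h []       = refl
  sum-map f h (x ∷ xs) = +-congˡ (sum-map f h xs)

  sum-concatMap : (f : B → Carrier) (h : A → List B) → ∀ xs →
                  sumOver f (concatMap h xs) ≈ sumOver (λ x → sumOver f (h x)) xs
  sum-concatMap f h []       = refl
  sum-concatMap f h (x ∷ xs) = trans (sum-++ f (h x) _) (+-congˡ (sum-concatMap f h xs))

  sum-swap : (f : A → B → Carrier) → ∀ xs ys →
             sumOver (λ x → sumOver (f x) ys) xs ≈ sumOver (λ y → sumOver (λ x → f x y) xs) ys
  sum-swap f []       ys = sym (sum-zero (λ _ → refl) ys)
  sum-swap f (x ∷ xs) ys = trans (+-congˡ (sum-swap f xs ys)) (sym (sum-+ (f x) _ ys))

  sum-applyUpTo-suc : (f : ℕ → Carrier) (h : ℕ → ℕ) → ∀ n →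
                      sumOver f (applyUpTo (suc ∘ h) n) ≈ sumOver (f ∘ suc) (applyUpTo h n)
  sum-applyUpTo-suc f h zero    = refl
  sum-applyUpTo-suc f h (suc n) = +-congˡ (sum-applyUpTo-suc f (h ∘ suc) n)

  sum-upTo-suc : (f : ℕ → Carrier) → ∀ n →
                 sumOver f (upTo (suc n)) ≈ f 0 + sumOver (f ∘ suc) (upTo n)
  sum-upTo-suc f n = +-congˡ (sum-applyUpTo-suc f id n)

  -- As `xs` is duplicate-free, its tail avoids its head and still embeds in `ys` after one
  -- occurrence of the head is deleted. The entries of `ys` left over at the end contribute
  -- nonnegative terms.
  sum-⊆ : {f : A → Carrier} → (∀ x → 0# ≼ f x) → ∀ {xs ys} → Unique xs → xs ⊆ ys →
          sumOver f xs ≼ sumOver f ys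
  sum-⊆ 0≼f {[]} {ys} _ _ = sum-nonneg 0≼f ys
  sum-⊆ {f = f} 0≼f {x ∷ xs} (x∉xs ∷ xs!) xs⊆ys with ∈-∃++ (xs⊆ys (here ≡.refl))
  ... | us , vs , ≡.refl = begin
    f x + sumOver f xs                  ≤⟨ +-monoʳ-≼ (f x) (sum-⊆ 0≼f xs! xs⊆us++vs) ⟩
    f x + sumOver f (us ++ vs)          ≈⟨ +-congˡ (sum-++ f us vs) ⟩
    f x + (sumOver f us + sumOver f vs) ≈⟨ solve 3 (λ a b c → a :+ (b :+ c) := b :+ (a :+ c)) refl _ _ _ ⟩
    sumOver f us + (f x + sumOver f vs) ≈⟨ sum-++ f us (x ∷ vs) ⟨
    sumOver f (us ++ x ∷ vs)            ∎
    where
    xs⊆us++vs : xs ⊆ us ++ vs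
    xs⊆us++vs y∈xs with ∈-++⁻ us (xs⊆ys (there y∈xs))
    ... | inj₁ y∈us            = ∈-++⁺ˡ y∈us
    ... | inj₂ (here ≡.refl)   = contradiction ≡.refl (All.lookup x∉xs y∈xs)
    ... | inj₂ (there y∈vs)    = ∈-++⁺ʳ us y∈vs

-- Exhaustion of countable sample spaces by finite stages

record Exhaustion (Ω : Set) : Set where
  field
    stage     : ℕ → List Ω
    unique    : ∀ n → Unique (stage n)
    monotone  : ∀ {m n} → m ≤ n → stage m ⊆ stage n
    exhausts  : ∀ ω → ∃[ n ] ω ∈ stage n

open Exhaustion public

⊤-exhaustion : Exhaustion ⊤
⊤-exhaustion .stage _      = tt ∷ []
⊤-exhaustion .unique _     = [] ∷ []
⊤-exhaustion .monotone _   = id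
⊤-exhaustion .exhausts _   = 0 , here ≡.refl

Bool-exhaustion : Exhaustion Bool
Bool-exhaustion .stage _        = true ∷ false ∷ []
Bool-exhaustion .unique _       = ((λ ()) ∷ []) ∷ [] ∷ []
Bool-exhaustion .monotone _     = id
Bool-exhaustion .exhausts true  = 0 , here ≡.refl
Bool-exhaustion .exhausts false = 0 , there (here ≡.refl)

-- The guards `True (C? x)` and `False (C? x)` in the sample space of a loop unfold to `T` of a
-- boolean, so this enumerates them by one point or none.
T-exhaustion : ∀ b → Exhaustion (T b)
T-exhaustion true  = ⊤-exhaustion
T-exhaustion false .stage _    = []
T-exhaustion false .unique _   = []
T-exhaustion false .monotone _ = id
T-exhaustion false .exhausts ()

ℕ-exhaustion : Exhaustion ℕ
ℕ-exhaustion .stage n          = upTo (suc n)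
ℕ-exhaustion .unique n         = Unique.upTo⁺ (suc n)
ℕ-exhaustion .monotone m≤n i∈  = ∈-upTo⁺ (ℕ.<-≤-trans (∈-upTo⁻ i∈) (s≤s m≤n))
ℕ-exhaustion .exhausts n       = n , ∈-upTo⁺ ℕ.≤-refl

module _ {A : Set} {B : A → Set} (EA : Exhaustion A) (EB : ∀ a → Exhaustion (B a)) where

  private
    fibre : ℕ → A → List (Σ A B)
    fibre n a = map (a ,_) (stage (EB a) n)

    ∈-fibre⁻ : ∀ {n a x} → x ∈ fibre n a → proj₁ x ≡ a
    ∈-fibre⁻ x∈ with ∈-map⁻ _ x∈
    ... | _ , _ , ≡.refl = ≡.refl

    disjoint-fibres : ∀ {n a a′} → a ≢ a′ → Disjoint (fibre n a) (fibre n a′)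
    disjoint-fibres a≢a′ (x∈ , x∈′) = a≢a′ (≡.trans (≡.sym (∈-fibre⁻ x∈)) (∈-fibre⁻ x∈′))

    pairs : ℕ → List (Σ A B)
    pairs n = concatMap (fibre n) (stage EA n)

    ∈-pairs⁺ : ∀ {n a b} → a ∈ stage EA n → b ∈ stage (EB a) n → (a , b) ∈ pairs n
    ∈-pairs⁺ a∈ b∈ = ∈-concatMap⁺ _ (Any.map (λ { ≡.refl → ∈-map⁺ _ b∈ }) a∈)

    ∈-pairs⁻ : ∀ {n a b} → (a , b) ∈ pairs n → a ∈ stage EA n × b ∈ stage (EB a) n
    ∈-pairs⁻ {n} ab∈ with find (∈-concatMap⁻ (fibre n) ab∈)
    ... | a , a∈ , ab∈′ with ∈-map⁻ _ ab∈′
    ...   | b , b∈ , ≡.refl = a∈ , b∈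

  -- One index serves the base and every fibre, so that stage `n` of a whole run bounds each of its
  -- loops by `n` iterations. A pair is caught at the later of the stages that catch its components.
  Σ-exhaustion : Exhaustion (Σ A B)
  Σ-exhaustion .stage = pairs
  Σ-exhaustion .unique n = Unique.concat⁺
    (All.map⁺ (All.universal (λ a → Unique.map⁺ (λ { ≡.refl → ≡.refl }) (unique (EB a) n)) _))
    (AllPairs.map⁺ (AllPairs.map disjoint-fibres (unique EA n)))
  Σ-exhaustion .monotone m≤n {a , b} x∈ with ∈-pairs⁻ x∈
  ... | a∈ , b∈ = ∈-pairs⁺ (monotone EA m≤n a∈) (monotone (EB a) m≤n b∈)
  Σ-exhaustion .exhausts (a , b) with exhausts EA a | exhausts (EB a) b
  ... | m , a∈ | n , b∈ =
    m ℕ.⊔ n , ∈-pairs⁺ (monotone EA (ℕ.m≤m⊔n m n) a∈) (monotone (EB a) (ℕ.m≤n⊔m m n) b∈)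

subset-of-stage : {Ω : Set} (E : Exhaustion Ω) → ∀ xs → ∃[ n ] xs ⊆ stage E n
subset-of-stage E []       = 0 , λ ()
subset-of-stage E (x ∷ xs) with exhausts E x | subset-of-stage E xs
... | m , x∈ | n , xs⊆ = m ℕ.⊔ n , λ
  { (here ≡.refl) → monotone E (ℕ.m≤m⊔n m n) x∈
  ; (there y∈xs)  → monotone E (ℕ.m≤n⊔m m n) (xs⊆ y∈xs)
  }

-- Infinite sums and expectations computed along stages

module Expectation
  {c ℓ₁ ℓ₂ ℓ₃ : Level} (K : ArchimedeanOrderedField c ℓ₁ ℓ₂ ℓ₃) where

  open ArchimedeanOrderedField K
  open Probability K
  open OrderedFieldProperties K
  open FiniteSums K
  open ≼-Reasoning

  private
    variable
      a b p : Level
      A : Set a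
      B : Set b
      X : Dist A

  -- Terms are nonnegative, so a finite set that contains a stage sums to at least as much as the
  -- stage, and a duplicate-free finite set, which lies in some later stage, to at most `μ`. The
  -- stage is chosen late enough for the geometric defect to fall below `ε`.
  hasSum-stages : {Ω′ : Set} (E : Exhaustion Ω′) {F : Ω′ → Carrier} {μ C γ : Carrier} →
    0# < γ → γ < 1# → (∀ ω → 0# ≼ F ω) →
    (∀ n → sumOver F (stage E n) ≼ μ) →
    (∀ n → μ ≼ sumOver F (stage E n) + C * γ ^ n) →
    HasSum F μ
  hasSum-stages E {F} {μ} {C} {γ} 0<γ γ<1 0≼F upper lower ε 0<ε =
    stage E n , λ ys ys! stage⊆ys → above ys stage⊆ys , below ys ys!
    where
    vanishing : ∃[ n ] C * γ ^ n < ε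
    vanishing = geometric-vanishes 0<γ γ<1 C ε 0<ε

    n = proj₁ vanishing

    above : ∀ ys → stage E n ⊆ ys → μ - ε < sumOver F ys
    above ys stage⊆ys = x<y+z⇒x-z<y (begin-strict
      μ                                <⟨ Order.≤-<-trans sym <-trans <-respˡ-≈ (lower n) (+-monoʳ-< _ (proj₂ vanishing)) ⟩
      sumOver F (stage E n) + ε        ≤⟨ +-monoˡ-≼ ε (sum-⊆ 0≼F (unique E n) stage⊆ys) ⟩
      sumOver F ys + ε                 ∎)

    below : ∀ ys → Unique ys → sumOver F ys < μ + ε
    below ys ys! with subset-of-stage E ys
    ... | m , ys⊆stage = begin-strict
      sumOver F ys           ≤⟨ sum-⊆ 0≼F ys! ys⊆stage ⟩
      sumOver F (stage E m)  ≤⟨ upper m ⟩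
      μ                      ≈⟨ +-identityʳ μ ⟨
      μ + 0#                 <⟨ +-monoʳ-< μ 0<ε ⟩
      μ + ε                  ∎

  -- `Ω X` does not determine `X`. The record keeps the weights and values of `X` attached to the
  -- enumeration of its sample space.
  record Enumerated {A : Set a} (X : Dist A) : Set where
    constructor enumerated
    field
      exhaustion : Exhaustion (Ω X)

  open Enumerated public

  return-enumerated : (x : A) → Enumerated (return x)
  return-enumerated x = enumerated ⊤-exhaustion

  bernoulli-enumerated : ∀ q → Enumerated (bernoulli q)
  bernoulli-enumerated q = enumerated Bool-exhaustion

  bind-enumerated : Enumerated X → {f : A → Dist B} → (∀ x → Enumerated (f x)) → Enumerated (X >>= f)
  bind-enumerated {X = X} EX Ef =
    enumerated (Σ-exhaustion (exhaustion EX) (λ ω → exhaustion (Ef (val X ω))))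

  -- The part of the expectation contributed by the n-th stage of the sample space.
  𝔼 : {X : Dist A} → Enumerated X → ℕ → (A → Carrier) → Carrier
  𝔼 {X = X} EX n f = sumOver (λ ω → ℙ X ω * f (val X ω)) (stage (exhaustion EX) n)

  NonNegative : Dist A → Set _
  NonNegative X = ∀ ω → 0# ≼ ℙ X ω

  Always : (A → Set p) → Dist A → Set p
  Always P X = ∀ ω → P (val X ω)

  𝔼-cong : (EX : Enumerated X) → ∀ n f g → Always (λ x → f x ≈ g x) X → 𝔼 EX n f ≈ 𝔼 EX n g
  𝔼-cong EX n f g f≈g = sum-cong (λ ω → *-congˡ (f≈g ω)) (stage (exhaustion EX) n)

  𝔼-mono : (EX : Enumerated X) → ∀ n f g → NonNegative X → Always (λ x → f x ≼ g x) X →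
           𝔼 EX n f ≼ 𝔼 EX n g
  𝔼-mono EX n f g 0≼ℙ f≼g = sum-mono (λ ω → *-monoʳ-≼ (0≼ℙ ω) (f≼g ω)) (stage (exhaustion EX) n)

  𝔼-nonneg : (EX : Enumerated X) → ∀ n f → NonNegative X → Always (λ x → 0# ≼ f x) X → 0# ≼ 𝔼 EX n f
  𝔼-nonneg EX n f 0≼ℙ 0≼f = sum-nonneg (λ ω → 0≼x*y (0≼ℙ ω) (0≼f ω)) (stage (exhaustion EX) n)

  𝔼-+ : (EX : Enumerated X) → ∀ n f g → 𝔼 EX n (λ x → f x + g x) ≈ 𝔼 EX n f + 𝔼 EX n g
  𝔼-+ EX n f g = trans (sum-cong (λ ω → distribˡ _ _ _) ωs) (sum-+ _ _ ωs)
    where ωs = stage (exhaustion EX) n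

  𝔼-*ˡ : (EX : Enumerated X) → ∀ n k f → 𝔼 EX n (λ x → k * f x) ≈ k * 𝔼 EX n f
  𝔼-*ˡ {X = X} EX n k f = trans
    (sum-cong (λ ω → solve 3 (λ p k y → p :* (k :* y) := k :* (p :* y)) refl (ℙ X ω) k (f (val X ω))) ωs)
    (sum-*ˡ k _ ωs)
    where ωs = stage (exhaustion EX) n

  𝔼-sum : (EX : Enumerated X) → ∀ n {I : Set} (f : I → A → Carrier) is →
          sumOver (λ i → 𝔼 EX n (f i)) is ≈ 𝔼 EX n (λ x → sumOver (λ i → f i x) is)
  𝔼-sum {X = X} EX n f is = trans (sum-swap _ is ωs)
    (sum-cong (λ ω → sum-*ˡ (ℙ X ω) (λ i → f i (val X ω)) is) ωs)
    where ωs = stage (exhaustion EX) n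

  𝔼-return : (x : A) → ∀ n f → 𝔼 (return-enumerated x) n f ≈ f x
  𝔼-return x n f = trans (+-identityʳ _) (*-identityˡ (f x))

  𝔼-bernoulli : ∀ q n f → 𝔼 (bernoulli-enumerated q) n f ≈ q * f true + (1# - q) * f false
  𝔼-bernoulli q n f = +-congˡ (+-identityʳ _)

  sum-Σ : {S : Set} {F : S → Set} (ES : Exhaustion S) (EF : ∀ s → Exhaustion (F s)) →
          ∀ n (f : Σ S F → Carrier) →
          sumOver f (stage (Σ-exhaustion ES EF) n)
            ≈ sumOver (λ s → sumOver (λ t → f (s , t)) (stage (EF s) n)) (stage ES n)
  sum-Σ ES EF n f = trans (sum-concatMap f _ (stage ES n))
    (sum-cong (λ s → sum-map f (s ,_) (stage (EF s) n)) (stage ES n))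

  -- The law of total expectation holds exactly at each finite stage, without a limit, because
  -- `Σ-exhaustion` cuts base and fibres at the same index.
  𝔼-bind : (EX : Enumerated X) {f : A → Dist B} (Ef : ∀ x → Enumerated (f x)) → ∀ n g →
           𝔼 (bind-enumerated EX Ef) n g ≈ 𝔼 EX n (λ x → 𝔼 (Ef x) n g)
  𝔼-bind {X = X} EX Ef n g = trans
    (sum-Σ (exhaustion EX) (λ ω → exhaustion (Ef (val X ω))) n _)
    (sum-cong (λ ω → trans
        (sum-cong (λ ω′ → *-assoc _ _ _) (stage (exhaustion (Ef (val X ω))) n))
        (sum-*ˡ (ℙ X ω) _ (stage (exhaustion (Ef (val X ω))) n)))
      (stage (exhaustion EX) n))

  bind-nonNegative : {f : A → Dist B} → NonNegative X → Always (λ x → NonNegative (f x)) X →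
                     NonNegative (X >>= f)
  bind-nonNegative 0≼X 0≼f (ω , ω′) = 0≼x*y (0≼X ω) (0≼f ω ω′)

  -- Truncated expectations and invariants of a loop

  module _ {A : Set a} {C : Pred A p} (C? : Decidable C) {body : A → Dist A}
           (Ebody : ∀ x → Enumerated (body x)) where

    iterations-enumerated : ∀ n x → Enumerated (iterations C? body n x)
    iterations-enumerated zero    x = enumerated (T-exhaustion _)
    iterations-enumerated (suc n) x = enumerated
      (Σ-exhaustion (T-exhaustion _) λ _ →
        exhaustion (bind-enumerated (Ebody x) (iterations-enumerated n)))

    while-enumerated : ∀ x → Enumerated (while C? body x)
    while-enumerated x = enumerated
      (Σ-exhaustion ℕ-exhaustion λ n → exhaustion (iterations-enumerated n x))

    -- Sums over at most i - 1 iterations of the loop.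
    𝔼≤ : ℕ → ℕ → (A → Carrier) → A → Carrier
    𝔼≤ i n f x = sumOver (λ k → 𝔼 (iterations-enumerated k x) n f) (upTo i)

    -- Stage `n` of `ℕ-exhaustion` consists of 0 to n, hence the bound `suc n`.
    𝔼-while : ∀ n x f → 𝔼 (while-enumerated x) n f ≈ 𝔼≤ (suc n) n f x
    𝔼-while n x f = sum-Σ ℕ-exhaustion (λ k → exhaustion (iterations-enumerated k x)) n _

    -- When the guard fails, the sample spaces of one or more iterations are empty, and the
    -- execution with no iterations is the only one.
    𝔼≤-halted : ∀ i n f x → ¬ C x → 𝔼≤ (suc i) n f x ≈ f x
    𝔼≤-halted i n f x ¬c = begin-equality
      𝔼≤ (suc i) n f x      ≈⟨ sum-upTo-suc _ i ⟩
      𝔼 (iterations-enumerated 0 x) n f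
        + sumOver (λ k → 𝔼 (iterations-enumerated (suc k) x) n f) (upTo i)
                            ≈⟨ +-cong first (sum-zero later (upTo i)) ⟩
      f x + 0#              ≈⟨ +-identityʳ (f x) ⟩
      f x                   ∎
      where
      first : 𝔼 (iterations-enumerated 0 x) n f ≈ f x
      first with C? x
      ... | yes c = contradiction c ¬c
      ... | no _  = trans (+-identityʳ _) (*-identityˡ (f x))

      later : ∀ k → 𝔼 (iterations-enumerated (suc k) x) n f ≈ 0#
      later k with C? x
      ... | yes c = contradiction c ¬c
      ... | no _  = refl

    -- When the guard holds, stopping at once is impossible, so every execution begins with a pass
    -- through the body and has one iteration fewer left. All estimates for the loop are inductions
    -- along this recursion.
    𝔼≤-running : ∀ i n f x → C x → 𝔼≤ (suc i) n f x ≈ 𝔼 (Ebody x) n (𝔼≤ i n f)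
    𝔼≤-running i n f x c = begin-equality
      𝔼≤ (suc i) n f x      ≈⟨ sum-upTo-suc _ i ⟩
      𝔼 (iterations-enumerated 0 x) n f
        + sumOver (λ k → 𝔼 (iterations-enumerated (suc k) x) n f) (upTo i)
                            ≈⟨ +-cong first (sum-cong later (upTo i)) ⟩
      0# + sumOver (λ k → 𝔼 (Ebody x) n (λ y → 𝔼 (iterations-enumerated k y) n f)) (upTo i)
                            ≈⟨ +-identityˡ _ ⟩
      sumOver (λ k → 𝔼 (Ebody x) n (λ y → 𝔼 (iterations-enumerated k y) n f)) (upTo i)
                            ≈⟨ 𝔼-sum (Ebody x) n (λ k y → 𝔼 (iterations-enumerated k y) n f) (upTo i) ⟩
      𝔼 (Ebody x) n (𝔼≤ i n f) ∎
      where
      first : 𝔼 (iterations-enumerated 0 x) n f ≈ 0#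
      first with C? x
      ... | yes _ = refl
      ... | no ¬c = contradiction c ¬c

      later : ∀ k → 𝔼 (iterations-enumerated (suc k) x) n f
                    ≈ 𝔼 (Ebody x) n (λ y → 𝔼 (iterations-enumerated k y) n f)
      later k with C? x
      ... | no ¬c = contradiction c ¬c
      ... | yes _ = begin-equality
        -- The guard has reduced to the unit type, so it contributes a single point to the sum.
        _ ≈⟨ sum-Σ ⊤-exhaustion (λ _ → exhaustion EI) n _ ⟩
        _ ≈⟨ +-identityʳ _ ⟩
        𝔼 EI n f ≈⟨ 𝔼-bind (Ebody x) (iterations-enumerated k) n f ⟩
        𝔼 (Ebody x) n (λ y → 𝔼 (iterations-enumerated k y) n f) ∎
        where EI = bind-enumerated (Ebody x) (iterations-enumerated k)

    iterations-nonNegative : (∀ x → NonNegative (body x)) → ∀ n x → NonNegative (iterations C? body n x)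
    iterations-nonNegative 0≼body zero    x ω       = 0≼1
    iterations-nonNegative 0≼body (suc n) x (_ , ω) =
      bind-nonNegative {X = body x} {f = iterations C? body n} (0≼body x)
        (λ ω → iterations-nonNegative 0≼body n (val (body x) ω)) ω

    while-nonNegative : (∀ x → NonNegative (body x)) → ∀ x → NonNegative (while C? body x)
    while-nonNegative 0≼body x (n , ω) = iterations-nonNegative 0≼body n x ω

    iterations-always : {P : A → Set b} → (∀ {x} → P x → Always P (body x)) →
                        ∀ n {x} → P x → Always P (iterations C? body n x)
    iterations-always inv zero    px ω             = px
    iterations-always inv (suc n) px (_ , ω , ω′) = iterations-always inv n (inv px ω) ω′

    while-always : {P : A → Set b} → (∀ {x} → P x → Always P (body x)) →
                   ∀ {x} → P x → Always P (while C? body x)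
    while-always inv px (n , ω) = iterations-always inv n px ω

-- Weighted sums over the sublists of a list

module SublistSums
  {c ℓ₁ ℓ₂ ℓ₃ : Level} (K : ArchimedeanOrderedField c ℓ₁ ℓ₂ ℓ₃) {E : Set} where

  open ArchimedeanOrderedField K
  open Probability K using (sumOver)
  open OrderedFieldProperties K
  open FiniteSums K
  open ≼-Reasoning

  sublistSum : (List E → Carrier) → List E → Carrier
  sublistSum g G = sumOver g (sublists G)

  -- Σ (|G| - |B|) g(B) over the sublists B of G.
  coSizeSum : (List E → Carrier) → List E → Carrier
  coSizeSum g []      = 0#
  coSizeSum g (e ∷ G) = coSizeSum (g ∘ (e ∷_)) G + (coSizeSum g G + sublistSum g G)

  sublistSum-∷ : ∀ g e G → sublistSum g (e ∷ G) ≈ sublistSum (g ∘ (e ∷_)) G + sublistSum g G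
  sublistSum-∷ g e G = trans (sum-++ g (map (e ∷_) (sublists G)) (sublists G))
    (+-congʳ (sum-map g (e ∷_) (sublists G)))

  sublistSum-cong : ∀ {g h} → (∀ B → g B ≈ h B) → ∀ G → sublistSum g G ≈ sublistSum h G
  sublistSum-cong g≈h G = sum-cong g≈h (sublists G)

  sublistSum-nonneg : ∀ {g} → (∀ B → 0# ≼ g B) → ∀ G → 0# ≼ sublistSum g G
  sublistSum-nonneg 0≼g G = sum-nonneg 0≼g (sublists G)

  coSizeSum-cong : ∀ {g h} → (∀ B → g B ≈ h B) → ∀ G → coSizeSum g G ≈ coSizeSum h G
  coSizeSum-cong g≈h []      = refl
  coSizeSum-cong g≈h (e ∷ G) =
    +-cong (coSizeSum-cong (g≈h ∘ (e ∷_)) G) (+-cong (coSizeSum-cong g≈h G) (sublistSum-cong g≈h G))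

  coSizeSum-nonneg : ∀ {g} → (∀ B → 0# ≼ g B) → ∀ G → 0# ≼ coSizeSum g G
  coSizeSum-nonneg 0≼g []      = ≼-refl
  coSizeSum-nonneg 0≼g (e ∷ G) =
    0≼x+y (coSizeSum-nonneg (0≼g ∘ (e ∷_)) G) (0≼x+y (coSizeSum-nonneg 0≼g G) (sublistSum-nonneg 0≼g G))

  coSizeSum-*ˡ : ∀ k g G → coSizeSum (λ B → k * g B) G ≈ k * coSizeSum g G
  coSizeSum-*ˡ k g []      = sym (zeroʳ k)
  coSizeSum-*ˡ k g (e ∷ G) = trans
    (+-cong (coSizeSum-*ˡ k (g ∘ (e ∷_)) G) (+-cong (coSizeSum-*ˡ k g G) (sum-*ˡ k g (sublists G))))
    (solve 4 (λ k a b c → k :* a :+ (k :* b :+ k :* c) := k :* (a :+ (b :+ c))) refl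
      k (coSizeSum (g ∘ (e ∷_)) G) (coSizeSum g G) (sublistSum g G))

  -- A sublist of `m` or more elements contributes zero, and a smaller one has coefficient |G| - |B|
  -- at least 1. In the induction the sublists that omit `e` are already counted once for `e`, and
  -- those that contain it are left to the induction hypothesis.
  sublistSum≼coSizeSum : ∀ m {g G} → (∀ B → 0# ≼ g B) → (∀ B → m ≤ length B → g B ≈ 0#) →
                         m ≤ length G → sublistSum g G ≼ coSizeSum g G
  sublistSum≼coSizeSum zero {g} {G} 0≼g g≈0 _ = begin
    sublistSum g G  ≈⟨ sum-zero (λ B → g≈0 B z≤n) (sublists G) ⟩
    0#              ≤⟨ coSizeSum-nonneg 0≼g G ⟩
    coSizeSum g G   ∎
  sublistSum≼coSizeSum (suc m) {g} {e ∷ G} 0≼g g≈0 (s≤s m≤|G|) = begin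
    sublistSum g (e ∷ G)                           ≈⟨ sublistSum-∷ g e G ⟩
    sublistSum (g ∘ (e ∷_)) G + sublistSum g G
      ≤⟨ +-mono-≼ (sublistSum≼coSizeSum m {G = G} (0≼g ∘ (e ∷_)) (λ B → g≈0 (e ∷ B) ∘ s≤s) m≤|G|)
                  (x≼y+x (coSizeSum-nonneg 0≼g G)) ⟩
    coSizeSum g (e ∷ G)                            ∎

  -- Each coefficient |G| - |B| is at most |G|.
  coSizeSum≼length*sublistSum : ∀ {g} → (∀ B → 0# ≼ g B) → ∀ G →
                                coSizeSum g G ≼ fromℕ (length G) * sublistSum g G
  coSizeSum≼length*sublistSum 0≼g []      = ≼-reflexive (sym (zeroˡ _))
  coSizeSum≼length*sublistSum {g} 0≼g (e ∷ G) = begin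
    coSizeSum (g ∘ (e ∷_)) G + (coSizeSum g G + b)
      ≤⟨ +-mono-≼ (≼-trans (coSizeSum≼length*sublistSum (0≼g ∘ (e ∷_)) G) (x≼y+x (sublistSum-nonneg (0≼g ∘ (e ∷_)) G)))
                  (+-monoˡ-≼ b (coSizeSum≼length*sublistSum 0≼g G)) ⟩
    a + n * a + (n * b + b)
      ≈⟨ solve 3 (λ n a b → a :+ n :* a :+ (n :* b :+ b) := (con 1 :+ n) :* (a :+ b)) refl n a b ⟩
    (1# + n) * (a + b)
      ≈⟨ *-congˡ (sublistSum-∷ g e G) ⟨
    (1# + n) * sublistSum g (e ∷ G)  ∎
    where
    n = fromℕ (length G)
    a = sublistSum (g ∘ (e ∷_)) G
    b = sublistSum g G

-- Subsampling, resampling and the while loop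

module Loop
  {c ℓ₁ ℓ₂ ℓ₃ : Level} (K : ArchimedeanOrderedField c ℓ₁ ℓ₂ ℓ₃)
  {L R : Set} (_≟ᴸ_ : DecidableEquality L) (_≟ᴿ_ : DecidableEquality R)
  (M : ℕ) (5≤M : 5 ≤ M)
  (γ : ArchimedeanOrderedField.Carrier K)
  (γ>0 : ArchimedeanOrderedField._<_ K (ArchimedeanOrderedField.0# K) γ)
  (γ<1 : ArchimedeanOrderedField._<_ K γ (ArchimedeanOrderedField.1# K))
  where

  open ArchimedeanOrderedField K
  open Probability K
  open Butterflies _≟ᴸ_ _≟ᴿ_ using (Edge)
  open FLEET1 K _≟ᴸ_ _≟ᴿ_ M γ γ>0
  open State
  open OrderedFieldProperties K
  open FiniteSums K
  open Expectation K
  open SublistSums K {Edge}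
  open ≼-Reasoning

  0≼γ : 0# ≼ γ
  0≼γ = inj₁ γ>0

  -- A coin of bias `x` decides whether `a` is added to `b`, which is present either way.
  interpolate : ∀ x a b → x * (a + b) + (1# - x) * b ≈ x * a + b
  interpolate x a b = begin-equality
    x * (a + b) + (1# - x) * b
      ≈⟨ solve 4 (λ x y a b → x :* (a :+ b) :+ y :* b := x :* a :+ (y :+ x) :* b) refl x (1# - x) a b ⟩
    x * a + (1# - x + x) * b  ≈⟨ +-congˡ (*-congʳ (y-x+x≈y x 1#)) ⟩
    x * a + 1# * b            ≈⟨ +-congˡ (*-identityˡ b) ⟩
    x * a + b                 ∎

  subsample-enumerated : ∀ G → Enumerated (subsample G)
  subsample-enumerated []      = return-enumerated []
  subsample-enumerated (e ∷ G) =
    bind-enumerated (bernoulli-enumerated γ) λ keep →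
    bind-enumerated (subsample-enumerated G) λ G′ →
    return-enumerated (if keep then e ∷ G′ else G′)

  𝔼-subsample-∷ : ∀ e G n f → 𝔼 (subsample-enumerated (e ∷ G)) n f ≈
    γ * 𝔼 (subsample-enumerated G) n (f ∘ (e ∷_)) + (1# - γ) * 𝔼 (subsample-enumerated G) n f
  𝔼-subsample-∷ e G n f = begin-equality
    𝔼 (subsample-enumerated (e ∷ G)) n f
      ≈⟨ 𝔼-bind (bernoulli-enumerated γ) rest n f ⟩
    𝔼 (bernoulli-enumerated γ) n (λ keep → 𝔼 (rest keep) n f)
      ≈⟨ 𝔼-bernoulli γ n (λ keep → 𝔼 (rest keep) n f) ⟩
    γ * 𝔼 (rest true) n f + (1# - γ) * 𝔼 (rest false) n f
      ≈⟨ +-cong (*-congˡ (𝔼-rest true)) (*-congˡ (𝔼-rest false)) ⟩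
    γ * 𝔼 (subsample-enumerated G) n (f ∘ (e ∷_)) + (1# - γ) * 𝔼 (subsample-enumerated G) n f ∎
    where
    ending : ∀ keep G′ → Enumerated (return (if keep then e ∷ G′ else G′))
    ending keep G′ = return-enumerated (if keep then e ∷ G′ else G′)

    rest : ∀ keep → Enumerated (subsample G >>= λ G′ → return (if keep then e ∷ G′ else G′))
    rest keep = bind-enumerated (subsample-enumerated G) (ending keep)

    𝔼-rest : ∀ keep → 𝔼 (rest keep) n f ≈ 𝔼 (subsample-enumerated G) n (λ G′ → f (if keep then e ∷ G′ else G′))
    𝔼-rest keep = trans (𝔼-bind (subsample-enumerated G) (ending keep) n f)
      (𝔼-cong (subsample-enumerated G) n (λ G′ → 𝔼 (ending keep G′) n f) (λ G′ → f (if keep then e ∷ G′ else G′))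
              (λ ω → 𝔼-return (if keep then e ∷ val (subsample G) ω else val (subsample G) ω) n f))

  -- The power of `γ` is the probability that all of `B` survives subsampling.
  thinned : (List Edge → Carrier) → List Edge → Carrier
  thinned g B = γ ^ length B * g B

  *-thinned : ∀ g e B → γ * thinned (g ∘ (e ∷_)) B ≈ thinned g (e ∷ B)
  *-thinned g e B = sym (*-assoc γ (γ ^ length B) (g (e ∷ B)))

  -- This is linearity of expectation: each sublist of `G` is still a sublist of the sample exactly
  -- when all its edges are kept. The induction tosses the coin of one edge at a time.
  𝔼-sublistSum : ∀ g G n → 𝔼 (subsample-enumerated G) n (sublistSum g) ≈ sublistSum (thinned g) G
  𝔼-sublistSum g [] n = trans (𝔼-return [] n (sublistSum g)) (+-congʳ (sym (*-identityˡ (g []))))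
  𝔼-sublistSum g (e ∷ G) n = begin-equality
    𝔼 (subsample-enumerated (e ∷ G)) n (sublistSum g)
      ≈⟨ 𝔼-subsample-∷ e G n (sublistSum g) ⟩
    γ * 𝔼 EG n (sublistSum g ∘ (e ∷_)) + (1# - γ) * 𝔼 EG n (sublistSum g)
      ≈⟨ +-congʳ (*-congˡ (trans (𝔼-cong EG n (sublistSum g ∘ (e ∷_)) (λ G′ → sublistSum (g ∘ (e ∷_)) G′ + sublistSum g G′)
                                         (λ ω → sublistSum-∷ g e (val (subsample G) ω)))
                                 (𝔼-+ EG n (sublistSum (g ∘ (e ∷_))) (sublistSum g)))) ⟩
    γ * (𝔼 EG n (sublistSum (g ∘ (e ∷_))) + 𝔼 EG n (sublistSum g)) + (1# - γ) * 𝔼 EG n (sublistSum g)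
      ≈⟨ interpolate γ _ _ ⟩
    γ * 𝔼 EG n (sublistSum (g ∘ (e ∷_))) + 𝔼 EG n (sublistSum g)
      ≈⟨ +-cong (*-congˡ (𝔼-sublistSum (g ∘ (e ∷_)) G n)) (𝔼-sublistSum g G n) ⟩
    γ * sublistSum (thinned (g ∘ (e ∷_))) G + sublistSum (thinned g) G
      ≈⟨ +-congʳ (sum-*ˡ γ (thinned (g ∘ (e ∷_))) (sublists G)) ⟨
    sublistSum (λ B → γ * thinned (g ∘ (e ∷_)) B) G + sublistSum (thinned g) G
      ≈⟨ +-congʳ (sublistSum-cong (*-thinned g e) G) ⟩
    sublistSum (thinned g ∘ (e ∷_)) G + sublistSum (thinned g) G
      ≈⟨ sublistSum-∷ (thinned g) e G ⟨
    sublistSum (thinned g) (e ∷ G) ∎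
    where EG = subsample-enumerated G

  -- `coSizeSum` counts each `B` once for every edge outside it. For such a pair to survive, |B| + 1
  -- distinct edges must be kept, whence one more factor `γ` than in `𝔼-sublistSum`.
  𝔼-coSizeSum : ∀ g G n → 𝔼 (subsample-enumerated G) n (coSizeSum g) ≈ γ * coSizeSum (thinned g) G
  𝔼-coSizeSum g [] n = trans (𝔼-return [] n (coSizeSum g)) (sym (zeroʳ γ))
  𝔼-coSizeSum g (e ∷ G) n = begin-equality
    𝔼 (subsample-enumerated (e ∷ G)) n (coSizeSum g)
      ≈⟨ 𝔼-subsample-∷ e G n (coSizeSum g) ⟩
    γ * 𝔼 EG n (λ G′ → coSizeSum g′ G′ + (coSizeSum g G′ + sublistSum g G′)) + (1# - γ) * 𝔼 EG n (coSizeSum g)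
      ≈⟨ +-congʳ (*-congˡ (trans (𝔼-+ EG n (coSizeSum g′) (λ G′ → coSizeSum g G′ + sublistSum g G′))
                                 (+-congˡ (𝔼-+ EG n (coSizeSum g) (sublistSum g))))) ⟩
    γ * (a + (b + d)) + (1# - γ) * b
      ≈⟨ +-congʳ (*-congˡ (solve 3 (λ a b d → a :+ (b :+ d) := a :+ d :+ b) refl a b d)) ⟩
    γ * (a + d + b) + (1# - γ) * b
      ≈⟨ interpolate γ (a + d) b ⟩
    γ * (a + d) + b
      ≈⟨ +-cong (*-congˡ (+-cong (𝔼-coSizeSum g′ G n) (𝔼-sublistSum g G n))) (𝔼-coSizeSum g G n) ⟩
    γ * (γ * coSizeSum (thinned g′) G + sublistSum (thinned g) G) + γ * coSizeSum (thinned g) G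
      ≈⟨ +-congʳ (*-congˡ (+-congʳ (trans (sym (coSizeSum-*ˡ γ (thinned g′) G)) (coSizeSum-cong (*-thinned g e) G)))) ⟩
    γ * (coSizeSum (thinned g ∘ (e ∷_)) G + sublistSum (thinned g) G) + γ * coSizeSum (thinned g) G
      ≈⟨ solve 4 (λ c x y z → c :* (x :+ z) :+ c :* y := c :* (x :+ (y :+ z))) refl
           γ (coSizeSum (thinned g ∘ (e ∷_)) G) (coSizeSum (thinned g) G) (sublistSum (thinned g) G) ⟩
    γ * coSizeSum (thinned g) (e ∷ G) ∎
    where
    EG = subsample-enumerated G
    g′ = g ∘ (e ∷_)
    a = 𝔼 EG n (coSizeSum g′)
    b = 𝔼 EG n (coSizeSum g)
    d = 𝔼 EG n (sublistSum g)

  bernoulli-nonNegative : ∀ {x} → 0# ≼ x → x ≼ 1# → NonNegative (bernoulli x)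
  bernoulli-nonNegative 0≼x x≼1 true  = 0≼x
  bernoulli-nonNegative 0≼x x≼1 false = x≼y⇒0≼y-x x≼1

  return-nonNegative : ∀ {a} {A : Set a} (x : A) → NonNegative (return x)
  return-nonNegative x _ = 0≼1

  subsample-nonNegative : ∀ G → NonNegative (subsample G)
  subsample-nonNegative []      = return-nonNegative {A = List Edge} []
  subsample-nonNegative (e ∷ G) (keep , ω , _) =
    0≼x*y (bernoulli-nonNegative 0≼γ (inj₁ γ<1) keep) (0≼x*y (subsample-nonNegative G ω) 0≼1)

  resampled : State → List Edge → State
  resampled s 𝓡′ = record { p = γ * p s ; p>0 = *-pos γ>0 (p>0 s) ; 𝓡 = 𝓡′
                          ; β = inv (γ * p s) (*-pos γ>0 (p>0 s)) ^ 4 * fromℕ (Butterflies.ξ _≟ᴸ_ _≟ᴿ_ 𝓡′) }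

  resample-enumerated : ∀ s → Enumerated (resample s)
  resample-enumerated s =
    bind-enumerated (subsample-enumerated (𝓡 s)) {λ 𝓡′ → return (resampled s 𝓡′)}
                    λ 𝓡′ → return-enumerated (resampled s 𝓡′)

  resample-nonNegative : ∀ s → NonNegative (resample s)
  resample-nonNegative s (ω , _) = 0≼x*y (subsample-nonNegative (𝓡 s) ω) 0≼1

  𝔼-resample : ∀ s n f → 𝔼 (resample-enumerated s) n f ≈ 𝔼 (subsample-enumerated (𝓡 s)) n (f ∘ resampled s)
  𝔼-resample s n f = trans
    (𝔼-bind (subsample-enumerated (𝓡 s)) (λ 𝓡′ → return-enumerated (resampled s 𝓡′)) n f)
    (𝔼-cong (subsample-enumerated (𝓡 s)) n (λ 𝓡′ → 𝔼 (return-enumerated (resampled s 𝓡′)) n f) (f ∘ resampled s)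
      (λ ω → 𝔼-return (resampled s (val (subsample (𝓡 s)) ω)) n f))

  p⁻¹ : State → Carrier
  p⁻¹ s = inv (p s) (p>0 s)

  p⁻¹-resampled : ∀ s 𝓡′ → γ * p⁻¹ (resampled s 𝓡′) ≈ p⁻¹ s
  p⁻¹-resampled s 𝓡′ = inv-unique (p>0 s) (begin-equality
    p s * (γ * q′)  ≈⟨ solve 3 (λ p c q → p :* (c :* q) := c :* p :* q) refl (p s) γ q′ ⟩
    γ * p s * q′    ≈⟨ *-invʳ (*-pos γ>0 (p>0 s)) ⟩
    1#              ∎)
    where q′ = p⁻¹ (resampled s 𝓡′)

  -- Horvitz–Thompson weighting: each edge of B was retained with probability p.
  reweighted : Carrier → (List Edge → Carrier) → List Edge → Carrier
  reweighted q g B = q ^ length B * g B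

  -- This cancellation makes resampling unbiased: 1/p grows by the factor 1/γ, so the weight of `B`
  -- grows by the inverse of its survival probability.
  thinned-reweighted : ∀ s 𝓡′ g B → thinned (reweighted (p⁻¹ (resampled s 𝓡′)) g) B ≈ reweighted (p⁻¹ s) g B
  thinned-reweighted s 𝓡′ g B = begin-equality
    γ ^ k * (q′ ^ k * g B)  ≈⟨ *-assoc _ _ _ ⟨
    γ ^ k * q′ ^ k * g B    ≈⟨ *-congʳ (^-distrib-* γ q′ k) ⟨
    (γ * q′) ^ k * g B      ≈⟨ *-congʳ (^-congˡ k (p⁻¹-resampled s 𝓡′)) ⟩
    p⁻¹ s ^ k * g B         ∎
    where
    k = length B
    q′ = p⁻¹ (resampled s 𝓡′)

  0≼reweighted : ∀ s {g} → (∀ B → 0# ≼ g B) → ∀ B → 0# ≼ reweighted (p⁻¹ s) g B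
  0≼reweighted s 0≼g B = 0≼x*y (inj₁ (0<^ (length B) (inv>0 (p>0 s)))) (0≼g B)

  -- The Horvitz-Thompson estimate, from the reservoir alone, of the sum of `g` over all sublists of
  -- the edges seen so far.
  potential : (List Edge → Carrier) → State → Carrier
  potential g s = sublistSum (reweighted (p⁻¹ s) g) (𝓡 s)

  loop-enumerated : ∀ s → Enumerated (while full? resample s)
  loop-enumerated = while-enumerated full? resample-enumerated

  module _ (g : List Edge → Carrier) (0≼g : ∀ B → 0# ≼ g B)
           (g-vanishes : ∀ B → 5 ≤ length B → g B ≈ 0#) where

    private
      value : State → Carrier
      value = potential g

      -- Bounds what the executions still in the loop contribute to the value of a state: they retain
      -- one of the |𝓡| - |B| > 0 edges outside B, so that their share shrinks by γ in each iteration.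
      loss : State → Carrier
      loss s = coSizeSum (reweighted (p⁻¹ s) g) (𝓡 s)

      loop : ℕ → ℕ → State → Carrier
      loop i n = 𝔼≤ full? resample-enumerated i n value

    0≼potential : ∀ s → 0# ≼ value s
    0≼potential s = sublistSum-nonneg (0≼reweighted s 0≼g) (𝓡 s)

    0≼loss : ∀ s → 0# ≼ loss s
    0≼loss s = coSizeSum-nonneg (0≼reweighted s 0≼g) (𝓡 s)

    -- A full reservoir has at least five edges, whereas `g` vanishes on sets of five or more, so
    -- every contributing `B` leaves an edge of the reservoir outside. With `M = 4` a full reservoir
    -- could be a single butterfly, which no halting execution of the loop would preserve.
    value≼loss : ∀ s → Full s → value s ≼ loss s
    value≼loss s full = sublistSum≼coSizeSum 5 {G = 𝓡 s} (0≼reweighted s 0≼g)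
      (λ B 5≤|B| → trans (*-congˡ (g-vanishes B 5≤|B|)) (zeroʳ _)) (ℕ.≤-trans 5≤M full)

    loss≼length*value : ∀ s → loss s ≼ fromℕ (length (𝓡 s)) * value s
    loss≼length*value s = coSizeSum≼length*sublistSum (0≼reweighted s 0≼g) (𝓡 s)

    𝔼-resample-value : ∀ s n → 𝔼 (resample-enumerated s) n value ≈ value s
    𝔼-resample-value s n = trans (𝔼-resample s n value)
      -- The new `p` is the same for every outcome of the subsampling, so `[]` serves as a
      -- placeholder for the new reservoir; likewise for the loss below.
      (trans (𝔼-sublistSum (reweighted (p⁻¹ (resampled s [])) g) (𝓡 s) n)
             (sublistSum-cong (thinned-reweighted s [] g) (𝓡 s)))

    𝔼-resample-loss : ∀ s n → 𝔼 (resample-enumerated s) n loss ≈ γ * loss s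
    𝔼-resample-loss s n = trans (𝔼-resample s n loss)
      (trans (𝔼-coSizeSum (reweighted (p⁻¹ (resampled s [])) g) (𝓡 s) n)
             (*-congˡ (coSizeSum-cong (thinned-reweighted s [] g) (𝓡 s))))

    -- A pass preserves the value on average, and truncation only drops nonnegative contributions of
    -- executions that have not halted.
    loop≼value : ∀ i n s → loop i n s ≼ value s
    loop≼value zero    n s = 0≼potential s
    loop≼value (suc i) n s = cases (full? s)
      where
      cases : Dec (Full s) → loop (suc i) n s ≼ value s
      cases (no ¬full) = ≼-reflexive (𝔼≤-halted full? resample-enumerated i n value s ¬full)
      cases (yes full) = begin
        loop (suc i) n s
          ≈⟨ 𝔼≤-running full? resample-enumerated i n value s full ⟩
        𝔼 (resample-enumerated s) n (loop i n)
          ≤⟨ 𝔼-mono (resample-enumerated s) n (loop i n) value (resample-nonNegative s) (λ ω → loop≼value i n _) ⟩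
        𝔼 (resample-enumerated s) n value
          ≈⟨ 𝔼-resample-value s n ⟩
        value s ∎

    -- The index `suc i` admits up to `i` passes, so what is missed is the value of the states still
    -- full after `i` passes. There the loss dominates the value, and on average each pass has
    -- multiplied the loss by `γ`.
    value≼loop+loss : ∀ i n s → value s ≼ loop (suc i) n s + γ ^ i * loss s
    value≼loop+loss i n s = cases i (full? s)
      where
      cases : ∀ i → Dec (Full s) → value s ≼ loop (suc i) n s + γ ^ i * loss s
      cases i (no ¬full) = begin
        value s                ≈⟨ 𝔼≤-halted full? resample-enumerated i n value s ¬full ⟨
        loop (suc i) n s       ≤⟨ x≼x+y (0≼x*y (inj₁ (0<^ i γ>0)) (0≼loss s)) ⟩
        loop (suc i) n s + γ ^ i * loss s ∎
      cases zero (yes full) = begin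
        value s                ≤⟨ value≼loss s full ⟩
        loss s                 ≈⟨ *-identityˡ (loss s) ⟨
        1# * loss s
          -- `loop 0 n` is an empty sum; its vanishing expectation is inserted to match
          -- `𝔼≤-running`.
          ≤⟨ x≼y+x (𝔼-nonneg (resample-enumerated s) n (loop 0 n) (resample-nonNegative s) (λ ω → ≼-refl)) ⟩
        𝔼 (resample-enumerated s) n (loop 0 n) + 1# * loss s
                               ≈⟨ +-congʳ (𝔼≤-running full? resample-enumerated 0 n value s full) ⟨
        loop 1 n s + 1# * loss s ∎
      cases (suc i) (yes full) = begin
        value s                ≈⟨ 𝔼-resample-value s n ⟨
        𝔼 (resample-enumerated s) n value
          ≤⟨ 𝔼-mono (resample-enumerated s) n value (λ s′ → loop (suc i) n s′ + γ ^ i * loss s′)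
               (resample-nonNegative s) (λ ω → value≼loop+loss i n _) ⟩
        𝔼 (resample-enumerated s) n (λ s′ → loop (suc i) n s′ + γ ^ i * loss s′)
          ≈⟨ 𝔼-+ (resample-enumerated s) n (loop (suc i) n) (λ s′ → γ ^ i * loss s′) ⟩
        𝔼 (resample-enumerated s) n (loop (suc i) n) + 𝔼 (resample-enumerated s) n (λ s′ → γ ^ i * loss s′)
          ≈⟨ +-cong (sym (𝔼≤-running full? resample-enumerated (suc i) n value s full))
                    (trans (𝔼-*ˡ (resample-enumerated s) n (γ ^ i) loss) (*-congˡ (𝔼-resample-loss s n))) ⟩
        loop (suc (suc i)) n s + γ ^ i * (γ * loss s)
          ≈⟨ +-congˡ (solve 3 (λ g c l → g :* (c :* l) := c :* g :* l) refl (γ ^ i) γ (loss s)) ⟩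
        loop (suc (suc i)) n s + γ ^ suc i * loss s ∎

    𝔼-while≼potential : ∀ n s → 𝔼 (loop-enumerated s) n value ≼ value s
    𝔼-while≼potential n s = ≼-trans (≼-reflexive (𝔼-while full? resample-enumerated n s value)) (loop≼value (suc n) n s)

    -- Stage `n` admits `n` passes. Bounding the loss by a multiple of the value makes the error
    -- proportional to the potential, a form that can be averaged over earlier arrivals.
    potential≼𝔼-while : ∀ n s → value s ≼ 𝔼 (loop-enumerated s) n value + γ ^ n * (fromℕ (length (𝓡 s)) * value s)
    potential≼𝔼-while n s = begin
      value s                                   ≤⟨ value≼loop+loss n n s ⟩
      loop (suc n) n s + γ ^ n * loss s
        ≤⟨ +-mono-≼ (≼-reflexive (sym (𝔼-while full? resample-enumerated n s value)))
                    (*-monoʳ-≼ (inj₁ (0<^ n γ>0)) (loss≼length*value s)) ⟩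
      𝔼 (loop-enumerated s) n value + γ ^ n * (fromℕ (length (𝓡 s)) * value s) ∎

-- Counting the butterflies created by a new edge

∉-sublists : {A : Set} {x : A} → ∀ xs → x ∉ xs → All (x ∉_) (sublists xs)
∉-sublists []       x∉xs = x∉xs ∷ []
∉-sublists (y ∷ xs) x∉xs = All.++⁺
  (All.map⁺ (All.map (λ { x∉B (here x≡y) → x∉xs (here x≡y) ; x∉B (there x∈B) → x∉B x∈B }) ih))
  ih
  where ih = ∉-sublists xs (x∉xs ∘ there)

module ButterflyCounts {L R : Set} (_≟ᴸ_ : DecidableEquality L) (_≟ᴿ_ : DecidableEquality R) where

  open Butterflies _≟ᴸ_ _≟ᴿ_
  open DecMembership _≟_ using (_∈?_)
  open ≡.≡-Reasoning

  isButterfly-resp-↭ : ∀ {B B′} → B ↭ B′ → IsButterfly B → IsButterfly B′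
  isButterfly-resp-↭ B↭B′ (a , b , x , y , a≢b , x≢y , B↭square) =
    a , b , x , y , a≢b , x≢y , ↭-trans (↭-sym B↭B′) B↭square

  isButterfly⇒length≡4 : ∀ {B} → IsButterfly B → length B ≡ 4
  isButterfly⇒length≡4 (_ , _ , _ , _ , _ , _ , B↭square) = ↭-length B↭square

  -- `sublists` lists the sets with `e` before those without it, and `e ∉ G` ensures that filtering
  -- by `e` keeps exactly the first group. Hence the increment in `insert` keeps `β` equal to q⁴
  -- times the count in the reservoir.
  ξ-∷ : ∀ e G → e ∉ G → ξ (e ∷ G) ≡ ξ G ℕ.+ ξ-containing e (e ∷ G)
  ξ-∷ e G e∉G = begin
    ξ (e ∷ G)                                             ≡⟨ ≡.cong length split ⟩
    length (new ++ butterflies G)                         ≡⟨ List.length-++ new ⟩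
    length new ℕ.+ ξ G                                    ≡⟨ ℕ.+-comm (length new) (ξ G) ⟩
    ξ G ℕ.+ length new                                    ≡⟨ ≡.cong (ξ G ℕ.+_) (≡.cong length containing) ⟨
    ξ G ℕ.+ ξ-containing e (e ∷ G)                        ∎
    where
    new : List (List Edge)
    new = filter isButterfly? (map (e ∷_) (sublists G))

    split : butterflies (e ∷ G) ≡ new ++ butterflies G
    split = List.filter-++ isButterfly? (map (e ∷_) (sublists G)) (sublists G)

    new∋e : All (e ∈_) new
    new∋e = All.filter⁺ isButterfly? (All.map⁺ (All.universal (λ _ → here ≡.refl) (sublists G)))

    old∌e : All (e ∉_) (butterflies G)
    old∌e = All.filter⁺ isButterfly? (∉-sublists G e∉G)

    containing : filter (e ∈?_) (butterflies (e ∷ G)) ≡ new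
    containing = begin
      filter (e ∈?_) (butterflies (e ∷ G))                             ≡⟨ ≡.cong (filter (e ∈?_)) split ⟩
      filter (e ∈?_) (new ++ butterflies G)                            ≡⟨ List.filter-++ (e ∈?_) new (butterflies G) ⟩
      filter (e ∈?_) new ++ filter (e ∈?_) (butterflies G)
        ≡⟨ ≡.cong₂ _++_ (List.filter-all (e ∈?_) new∋e) (List.filter-none (e ∈?_) old∌e) ⟩
      new ++ []                                                        ≡⟨ List.++-identityʳ new ⟩
      new                                                              ∎

-- Processing the arriving edges

module Arrivals
  {c ℓ₁ ℓ₂ ℓ₃ : Level} (K : ArchimedeanOrderedField c ℓ₁ ℓ₂ ℓ₃)
  {L R : Set} (_≟ᴸ_ : DecidableEquality L) (_≟ᴿ_ : DecidableEquality R)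
  (M : ℕ) (5≤M : 5 ≤ M)
  (γ : ArchimedeanOrderedField.Carrier K)
  (γ>0 : ArchimedeanOrderedField._<_ K (ArchimedeanOrderedField.0# K) γ)
  (γ<1 : ArchimedeanOrderedField._<_ K γ (ArchimedeanOrderedField.1# K))
  where

  open ArchimedeanOrderedField K
  open Probability K
  open Butterflies _≟ᴸ_ _≟ᴿ_
  open ButterflyCounts _≟ᴸ_ _≟ᴿ_
  open FLEET1 K _≟ᴸ_ _≟ᴿ_ M γ γ>0
  open State
  open OrderedFieldProperties K
  open FiniteSums K
  open Expectation K
  open SublistSums K {Edge}
  open Loop K _≟ᴸ_ _≟ᴿ_ M 5≤M γ γ>0 γ<1
  open import Algebra.Properties.Monoid.Mult (CommutativeRing.+-monoid commutativeRing) using (×-homo-+)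
  open ≼-Reasoning

  arrive-enumerated : ∀ e s → Enumerated (arrive e s)
  arrive-enumerated e s =
    bind-enumerated (loop-enumerated s) λ s′ →
    bind-enumerated (bernoulli-enumerated (p s′)) λ coin →
    return-enumerated (if coin then insert e s′ else s′)

  process-enumerated : ∀ es s → Enumerated (process es s)
  process-enumerated []       s = return-enumerated s
  process-enumerated (e ∷ es) s = bind-enumerated (arrive-enumerated e s) (process-enumerated es)

  𝔼-arrive : ∀ e s n f → 𝔼 (arrive-enumerated e s) n f ≈
             𝔼 (loop-enumerated s) n (λ s′ → p s′ * f (insert e s′) + (1# - p s′) * f s′)
  𝔼-arrive e s n f = trans (𝔼-bind (loop-enumerated s) toss n f)
    (𝔼-cong (loop-enumerated s) n (λ s′ → 𝔼 (toss s′) n f) (λ s′ → p s′ * f (insert e s′) + (1# - p s′) * f s′)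
      (λ ω → 𝔼-toss (val (while full? resample s) ω)))
    where
    ending : ∀ s′ coin → Enumerated (return (if coin then insert e s′ else s′))
    ending s′ coin = return-enumerated (if coin then insert e s′ else s′)

    toss : ∀ s′ → Enumerated (bernoulli (p s′) >>= λ coin → return (if coin then insert e s′ else s′))
    toss s′ = bind-enumerated (bernoulli-enumerated (p s′)) (ending s′)

    𝔼-toss : ∀ s′ → 𝔼 (toss s′) n f ≈ p s′ * f (insert e s′) + (1# - p s′) * f s′
    𝔼-toss s′ = begin-equality
      𝔼 (toss s′) n f
        ≈⟨ 𝔼-bind (bernoulli-enumerated (p s′)) (ending s′) n f ⟩
      𝔼 (bernoulli-enumerated (p s′)) n (λ coin → 𝔼 (ending s′ coin) n f)
        ≈⟨ 𝔼-bernoulli (p s′) n (λ coin → 𝔼 (ending s′ coin) n f) ⟩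
      p s′ * 𝔼 (ending s′ true) n f + (1# - p s′) * 𝔼 (ending s′ false) n f
        ≈⟨ +-cong (*-congˡ (𝔼-return (insert e s′) n f)) (*-congˡ (𝔼-return s′ n f)) ⟩
      p s′ * f (insert e s′) + (1# - p s′) * f s′ ∎

  subsample-⊆ : ∀ G → Always (_⊆ G) (subsample G)
  subsample-⊆ []      _                ()
  subsample-⊆ (e ∷ G) (true  , ω , _) (here e≡)  = here e≡
  subsample-⊆ (e ∷ G) (true  , ω , _) (there e∈) = there (subsample-⊆ G ω e∈)
  subsample-⊆ (e ∷ G) (false , ω , _) e∈         = there (subsample-⊆ G ω e∈)

  length-subsample : ∀ G → Always (λ G′ → length G′ ≤ length G) (subsample G)
  length-subsample []      _                = z≤n
  length-subsample (e ∷ G) (true  , ω , _) = s≤s (length-subsample G ω)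
  length-subsample (e ∷ G) (false , ω , _) = ℕ.m≤n⇒m≤1+n (length-subsample G ω)

  -- Here `es` are the edges still to come. `p≼1` makes the coins genuine probabilities and `fresh`
  -- permits `ξ-∷`. Counting `es` in `bounded` keeps one bound `T` on the reservoir for the whole
  -- run, as an insertion merely moves an edge from one summand to the other.
  record Invariant (T : ℕ) (es : List Edge) (s : State) : Set (c Level.⊔ ℓ₁ Level.⊔ ℓ₃) where
    field
      p≼1      : p s ≼ 1#
      fresh    : All (_∉ 𝓡 s) es
      bounded  : length (𝓡 s) ℕ.+ length es ≤ T
      estimate : β s ≈ p⁻⁴ s * fromℕ (ξ (𝓡 s))

  open Invariant

  initial-invariant : ∀ es → Invariant (length es) es initial
  initial-invariant es = record
    { p≼1      = ≼-refl
    ; fresh    = All.universal (λ _ ()) es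
    ; bounded  = ℕ.≤-refl
    ; estimate = sym (zeroʳ _)
    }

  resample-invariant : ∀ {T es s} → Invariant T es s → Always (Invariant T es) (resample s)
  resample-invariant {s = s} I (ω , _) = record
    { p≼1      = begin
        γ * p s  ≤⟨ *-monoʳ-≼ 0≼γ (p≼1 I) ⟩
        γ * 1#   ≈⟨ *-identityʳ γ ⟩
        γ        ≤⟨ inj₁ γ<1 ⟩
        1#       ∎
    ; fresh    = All.map (λ e∉ e∈ → e∉ (subsample-⊆ (𝓡 s) ω e∈)) (fresh I)
    ; bounded  = ℕ.≤-trans (ℕ.+-monoˡ-≤ _ (length-subsample (𝓡 s) ω)) (bounded I)
    -- `resample` recomputes `β` in exactly this form.
    ; estimate = refl
    }

  while-invariant : ∀ {T es s} → Invariant T es s → Always (Invariant T es) (while full? resample s)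
  while-invariant {T} {es} = while-always full? resample-enumerated {P = Invariant T es} resample-invariant

  insert-invariant : ∀ {T e es s} → All (e ≢_) es → Invariant T (e ∷ es) s → Invariant T es (insert e s)
  insert-invariant {T} {e} {es} {s} e∉es I = record
    { p≼1      = p≼1 I
    ; fresh    = All.map (λ { (e≢e′ , e′∉) (here e′≡e) → e≢e′ (≡.sym e′≡e)
                            ; (e≢e′ , e′∉) (there e′∈) → e′∉ e′∈ })
                         (All.zip (e∉es , All.tail (fresh I)))
    ; bounded  = ≡.subst (_≤ T) (ℕ.+-suc (length (𝓡 s)) (length es)) (bounded I)
    ; estimate = begin-equality
        β s + q⁴ * fromℕ b                     ≈⟨ +-congʳ (estimate I) ⟩
        q⁴ * fromℕ (ξ (𝓡 s)) + q⁴ * fromℕ b    ≈⟨ distribˡ q⁴ _ _ ⟨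
        q⁴ * (fromℕ (ξ (𝓡 s)) + fromℕ b)       ≈⟨ *-congˡ (×-homo-+ 1# (ξ (𝓡 s)) b) ⟨
        q⁴ * fromℕ (ξ (𝓡 s) ℕ.+ b)             ≡⟨ ≡.cong (λ m → q⁴ * fromℕ m) (ξ-∷ e (𝓡 s) (All.head (fresh I))) ⟨
        q⁴ * fromℕ (ξ (e ∷ 𝓡 s))               ∎
    }
    where
    q⁴ = p⁻⁴ s
    b  = ξ-containing e (e ∷ 𝓡 s)

  skip-invariant : ∀ {T e es s} → Invariant T (e ∷ es) s → Invariant T es s
  skip-invariant {s = s} I = record
    { p≼1      = p≼1 I
    ; fresh    = All.tail (fresh I)
    ; bounded  = ℕ.≤-trans (ℕ.+-monoʳ-≤ (length (𝓡 s)) (ℕ.n≤1+n _)) (bounded I)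
    ; estimate = estimate I
    }

  arrive-invariant : ∀ {T e es s} → All (e ≢_) es → Invariant T (e ∷ es) s → Always (Invariant T es) (arrive e s)
  arrive-invariant e∉es I (ω , true  , _) = insert-invariant e∉es (while-invariant I ω)
  arrive-invariant e∉es I (ω , false , _) = skip-invariant (while-invariant I ω)

  process-invariant : ∀ {T} es {s} → Unique es → Invariant T es s → Always (Invariant T []) (process es s)
  process-invariant []       _            I _        = I
  process-invariant (e ∷ es) (e∉es ∷ es!) I (ω , ω′) = process-invariant es es! (arrive-invariant e∉es I ω) ω′

  arrive-nonNegative : ∀ {T es s} e → Invariant T es s → NonNegative (arrive e s)
  arrive-nonNegative {s = s} e I (ω , coin , _) =
    0≼x*y (while-nonNegative full? resample-enumerated resample-nonNegative s ω)
          (0≼x*y (bernoulli-nonNegative (inj₁ (p>0 s′)) (p≼1 (while-invariant I ω)) coin) 0≼1)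
    where s′ = val (while full? resample s) ω

  process-nonNegative : ∀ {T} es {s} → Unique es → Invariant T es s → NonNegative (process es s)
  process-nonNegative []       _            I _        = 0≼1
  process-nonNegative (e ∷ es) (e∉es ∷ es!) I (ω , ω′) =
    0≼x*y (arrive-nonNegative e I ω) (process-nonNegative es es! (arrive-invariant e∉es I ω) ω′)

  -- The martingale of a weight on edge sets

  record Weight : Set (c Level.⊔ ℓ₁ Level.⊔ ℓ₃) where
    field
      weight    : List Edge → Carrier
      0≼weight  : ∀ B → 0# ≼ weight B
      vanishes  : ∀ B → 5 ≤ length B → weight B ≈ 0#
      invariant : ∀ {B B′} → B ↭ B′ → weight B ≈ weight B′

  module Martingale (W : Weight) where

    open Weight W

    -- The total weight of the sets obtained by completing `B` with edges still to come.
    extended : List Edge → List Edge → Carrier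
    extended es B = sublistSum (λ B′ → weight (B ++ B′)) es

    0≼extended : ∀ es B → 0# ≼ extended es B
    0≼extended es B = sublistSum-nonneg (λ B′ → 0≼weight (B ++ B′)) es

    extended-vanishes : ∀ es B → 5 ≤ length B → extended es B ≈ 0#
    extended-vanishes es B 5≤|B| = sum-zero
      (λ B′ → vanishes (B ++ B′) (ℕ.≤-trans 5≤|B|
        (≡.subst (length B ≤_) (≡.sym (List.length-++ B)) (ℕ.m≤m+n (length B) (length B′)))))
      (sublists es)

    -- The expected final value of `Φ []` when `s` is reached with `es` still to come: retained
    -- edges carry the factor 1/p, future ones the factor 1. Looking ahead in this way keeps the
    -- target sum fixed while the stream is consumed.
    Φ : List Edge → State → Carrier
    Φ es = potential (extended es)

    0≼Φ : ∀ es s → 0# ≼ Φ es s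
    0≼Φ es = 0≼potential (extended es) (0≼extended es) (extended-vanishes es)

    extended-∷ : ∀ e es B → extended (e ∷ es) B ≈ extended es (e ∷ B) + extended es B
    extended-∷ e es B = trans (sublistSum-∷ (λ B′ → weight (B ++ B′)) e es)
      -- Invariance under permutation lets the future edge `e` join `B` at the front.
      (+-congʳ (sublistSum-cong (λ B′ → invariant (shift e B B′)) es))

    Φ-toss : ∀ e es s → p s * Φ es (insert e s) + (1# - p s) * Φ es s ≈ Φ (e ∷ es) s
    Φ-toss e es s = begin-equality
      p s * Φ es (insert e s) + (1# - p s) * Φ es s
        ≈⟨ +-congʳ (*-congˡ (sublistSum-∷ g e (𝓡 s))) ⟩
      p s * (sublistSum (g ∘ (e ∷_)) (𝓡 s) + Φ es s) + (1# - p s) * Φ es s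
        ≈⟨ interpolate (p s) _ _ ⟩
      p s * sublistSum (g ∘ (e ∷_)) (𝓡 s) + Φ es s
        ≈⟨ +-congʳ (sum-*ˡ (p s) (g ∘ (e ∷_)) (sublists (𝓡 s))) ⟨
      sublistSum (λ B → p s * g (e ∷ B)) (𝓡 s) + Φ es s
        ≈⟨ sum-+ (λ B → p s * g (e ∷ B)) g (sublists (𝓡 s)) ⟨
      sublistSum (λ B → p s * g (e ∷ B) + g B) (𝓡 s)
        ≈⟨ sublistSum-cong step (𝓡 s) ⟩
      Φ (e ∷ es) s ∎
      where
      q = p⁻¹ s
      g = reweighted q (extended es)

      step : ∀ B → p s * g (e ∷ B) + g B ≈ reweighted q (extended (e ∷ es)) B
      step B = begin-equality
        p s * (q * q ^ k * x) + q ^ k * y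
          ≈⟨ solve 5 (λ p q r x y → p :* (q :* r :* x) :+ r :* y := r :* (p :* q :* x :+ y)) refl (p s) q (q ^ k) x y ⟩
        q ^ k * (p s * q * x + y)            ≈⟨ *-congˡ (+-congʳ (trans (*-congʳ (*-invʳ (p>0 s))) (*-identityˡ x))) ⟩
        q ^ k * (x + y)                      ≈⟨ *-congˡ (extended-∷ e es B) ⟨
        q ^ k * extended (e ∷ es) B          ∎
        where
        k = length B
        x = extended es (e ∷ B)
        y = extended es B

    𝔼-arrive-Φ : ∀ e es s n → 𝔼 (arrive-enumerated e s) n (Φ es) ≈ 𝔼 (loop-enumerated s) n (Φ (e ∷ es))
    𝔼-arrive-Φ e es s n = trans (𝔼-arrive e s n (Φ es))
      (𝔼-cong (loop-enumerated s) n (λ s′ → p s′ * Φ es (insert e s′) + (1# - p s′) * Φ es s′) (Φ (e ∷ es))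
        (λ ω → Φ-toss e es (val (while full? resample s) ω)))

    𝔼-arrive≼Φ : ∀ e es s n → 𝔼 (arrive-enumerated e s) n (Φ es) ≼ Φ (e ∷ es) s
    𝔼-arrive≼Φ e es s n = ≼-trans (≼-reflexive (𝔼-arrive-Φ e es s n))
      (𝔼-while≼potential (extended (e ∷ es)) (0≼extended (e ∷ es)) (extended-vanishes (e ∷ es)) n s)

    Φ≼𝔼-arrive : ∀ {T} e es s n → Invariant T (e ∷ es) s →
      Φ (e ∷ es) s ≼ 𝔼 (arrive-enumerated e s) n (Φ es) + γ ^ n * (fromℕ T * Φ (e ∷ es) s)
    Φ≼𝔼-arrive {T} e es s n I = begin
      Φ (e ∷ es) s
        ≤⟨ potential≼𝔼-while (extended (e ∷ es)) (0≼extended (e ∷ es)) (extended-vanishes (e ∷ es)) n s ⟩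
      𝔼 (loop-enumerated s) n (Φ (e ∷ es)) + γ ^ n * (fromℕ (length (𝓡 s)) * Φ (e ∷ es) s)
        ≤⟨ +-mono-≼ (≼-reflexive (sym (𝔼-arrive-Φ e es s n)))
             (*-monoʳ-≼ (inj₁ (0<^ n γ>0)) (*-monoˡ-≼ (0≼Φ (e ∷ es) s)
               (fromℕ-mono (ℕ.≤-trans (ℕ.m≤m+n (length (𝓡 s)) (length (e ∷ es))) (bounded I))))) ⟩
      𝔼 (arrive-enumerated e s) n (Φ es) + γ ^ n * (fromℕ T * Φ (e ∷ es) s) ∎

    𝔼-process≼Φ : ∀ {T} es s n → Unique es → Invariant T es s →
      𝔼 (process-enumerated es s) n (Φ []) ≼ Φ es s
    𝔼-process≼Φ []       s n _            I = ≼-reflexive (𝔼-return s n (Φ []))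
    𝔼-process≼Φ (e ∷ es) s n (e∉es ∷ es!) I = begin
      𝔼 (process-enumerated (e ∷ es) s) n (Φ [])
        ≈⟨ 𝔼-bind (arrive-enumerated e s) (process-enumerated es) n (Φ []) ⟩
      𝔼 (arrive-enumerated e s) n (λ s′ → 𝔼 (process-enumerated es s′) n (Φ []))
        ≤⟨ 𝔼-mono (arrive-enumerated e s) n (λ s′ → 𝔼 (process-enumerated es s′) n (Φ [])) (Φ es) (arrive-nonNegative e I)
             (λ ω → 𝔼-process≼Φ es (val (arrive e s) ω) n es! (arrive-invariant e∉es I ω)) ⟩
      𝔼 (arrive-enumerated e s) n (Φ es)
        ≤⟨ 𝔼-arrive≼Φ e es s n ⟩
      Φ (e ∷ es) s ∎

    -- Each arrival loses at most the fraction `γ ^ n * fromℕ T` of the potential before it. By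
    -- `𝔼-arrive≼Φ` the truncated expectation of the potential never exceeds its starting value, so
    -- the losses add up to at most `length es` such fractions of that value.
    Φ≼𝔼-process : ∀ {T} es s n → Unique es → Invariant T es s →
      Φ es s ≼ 𝔼 (process-enumerated es s) n (Φ []) + fromℕ (length es) * (γ ^ n * fromℕ T) * Φ es s
    Φ≼𝔼-process {T} [] s n _ I = begin
      Φ [] s                                ≈⟨ 𝔼-return s n (Φ []) ⟨
      𝔼 (process-enumerated [] s) n (Φ [])  ≤⟨ x≼x+y (≼-reflexive (sym (trans (*-congʳ (zeroˡ _)) (zeroˡ _)))) ⟩
      𝔼 (process-enumerated [] s) n (Φ []) + 0# * (γ ^ n * fromℕ T) * Φ [] s ∎
    Φ≼𝔼-process {T} (e ∷ es) s n (e∉es ∷ es!) I = begin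
      v
        ≤⟨ Φ≼𝔼-arrive e es s n I ⟩
      𝔼 Ea n (Φ es) + γ ^ n * (fromℕ T * v)
        ≤⟨ +-monoˡ-≼ _ (𝔼-mono Ea n (Φ es) (λ s′ → final s′ + jδ * Φ es s′) (arrive-nonNegative e I)
             (λ ω → Φ≼𝔼-process es (val (arrive e s) ω) n es! (arrive-invariant e∉es I ω))) ⟩
      𝔼 Ea n (λ s′ → final s′ + jδ * Φ es s′) + γ ^ n * (fromℕ T * v)
        ≈⟨ +-congʳ (trans (𝔼-+ Ea n final (λ s′ → jδ * Φ es s′)) (+-congˡ (𝔼-*ˡ Ea n jδ (Φ es)))) ⟩
      𝔼 Ea n final + jδ * 𝔼 Ea n (Φ es) + γ ^ n * (fromℕ T * v)
        ≤⟨ +-monoˡ-≼ _ (+-mono-≼ (≼-reflexive (sym (𝔼-bind Ea (process-enumerated es) n (Φ []))))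
                                 (*-monoʳ-≼ 0≼jδ (𝔼-arrive≼Φ e es s n))) ⟩
      𝔼 (process-enumerated (e ∷ es) s) n (Φ []) + jδ * v + γ ^ n * (fromℕ T * v)
        ≈⟨ solve 5 (λ x j g t v → x :+ j :* (g :* t) :* v :+ g :* (t :* v) := x :+ (con 1 :+ j) :* (g :* t) :* v) refl
             (𝔼 (process-enumerated (e ∷ es) s) n (Φ [])) (fromℕ (length es)) (γ ^ n) (fromℕ T) v ⟩
      𝔼 (process-enumerated (e ∷ es) s) n (Φ []) + fromℕ (length (e ∷ es)) * (γ ^ n * fromℕ T) * v ∎
      where
      Ea = arrive-enumerated e s
      v = Φ (e ∷ es) s
      final : State → Carrier
      final s′ = 𝔼 (process-enumerated es s′) n (Φ [])
      jδ = fromℕ (length es) * (γ ^ n * fromℕ T)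
      0≼jδ : 0# ≼ jδ
      0≼jδ = 0≼x*y (0≼fromℕ (length es)) (0≼x*y (inj₁ (0<^ n γ>0)) (0≼fromℕ T))

    -- Before the first edge the reservoir has the empty sublist alone, and all the weight lies in
    -- the future.
    Φ-initial : ∀ es → Φ es initial ≈ sublistSum weight es
    Φ-initial es = trans (+-identityʳ _) (*-identityˡ _)

    -- `F` is `ℙ ω * f (val ω)`, abstracted so that it covers the total mass `f = λ _ → 1#`.
    hasSum-process : ∀ es → Unique es → {A : Set c} (h : State → A) (f : A → Carrier) →
      let X = process es initial >>= λ s → return (h s) in
      (F : Ω X → Carrier) → (∀ ω → F ω ≈ ℙ X ω * f (val X ω)) →
      (∀ {s} → Invariant (length es) [] s → f (h s) ≈ Φ [] s) →
      HasSum F (sublistSum weight es)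
    hasSum-process es es! h f F F≈ f∘h≈Φ =
      hasSum-stages (exhaustion EX) γ>0 γ<1 0≼F upper lower
      where
      I₀ = initial-invariant es
      Ep = process-enumerated es initial
      X  = process es initial >>= λ s → return (h s)

      EX : Enumerated X
      EX = bind-enumerated Ep (λ s → return-enumerated (h s))

      μ = sublistSum weight es

      -- One factor `fromℕ (length es)` counts the arrivals, the other is the bound `T` on the
      -- reservoir.
      C : Carrier
      C = fromℕ (length es) * fromℕ (length es) * μ

      0≼F : ∀ ω → 0# ≼ F ω
      0≼F ω@(ω′ , _) = ≼-trans
        (0≼x*y (0≼x*y (process-nonNegative es es! I₀ ω′) 0≼1)
               (≼-trans (0≼Φ [] s) (≼-reflexive (sym (f∘h≈Φ (process-invariant es es! I₀ ω′))))))
        (≼-reflexive (sym (F≈ ω)))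
        where s = val (process es initial) ω′

      stage≈ : ∀ n → sumOver F (stage (exhaustion EX) n) ≈ 𝔼 Ep n (Φ [])
      stage≈ n = begin-equality
        sumOver F (stage (exhaustion EX) n)
          ≈⟨ sum-cong F≈ (stage (exhaustion EX) n) ⟩
        𝔼 EX n f
          ≈⟨ 𝔼-bind Ep (λ s → return-enumerated (h s)) n f ⟩
        𝔼 Ep n (λ s → 𝔼 (return-enumerated (h s)) n f)
          ≈⟨ 𝔼-cong Ep n (λ s → 𝔼 (return-enumerated (h s)) n f) (Φ [])
               (λ ω → trans (𝔼-return (h (val (process es initial) ω)) n f)
                            (f∘h≈Φ (process-invariant es es! I₀ ω))) ⟩
        𝔼 Ep n (Φ []) ∎

      upper : ∀ n → sumOver F (stage (exhaustion EX) n) ≼ μ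
      upper n = begin
        sumOver F (stage (exhaustion EX) n)  ≈⟨ stage≈ n ⟩
        𝔼 Ep n (Φ [])                        ≤⟨ 𝔼-process≼Φ es initial n es! I₀ ⟩
        Φ es initial                         ≈⟨ Φ-initial es ⟩
        μ                                    ∎

      lower : ∀ n → μ ≼ sumOver F (stage (exhaustion EX) n) + C * γ ^ n
      lower n = begin
        μ                                                ≈⟨ Φ-initial es ⟨
        Φ es initial                                     ≤⟨ Φ≼𝔼-process es initial n es! I₀ ⟩
        𝔼 Ep n (Φ []) + t * (γ ^ n * t) * Φ es initial
          ≈⟨ +-cong (sym (stage≈ n)) (trans (*-congˡ (Φ-initial es))
               (solve 3 (λ t g m → t :* (g :* t) :* m := t :* t :* m :* g) refl t (γ ^ n) μ)) ⟩
        sumOver F (stage (exhaustion EX) n) + C * γ ^ n  ∎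
        where t = fromℕ (length es)

-- Total mass and mean of the estimator

module Unbiasedness
  {c ℓ₁ ℓ₂ ℓ₃ : Level} (K : ArchimedeanOrderedField c ℓ₁ ℓ₂ ℓ₃)
  {L R : Set} (_≟ᴸ_ : DecidableEquality L) (_≟ᴿ_ : DecidableEquality R)
  (M : ℕ) (5≤M : 5 ≤ M)
  (γ : ArchimedeanOrderedField.Carrier K)
  (γ>0 : ArchimedeanOrderedField._<_ K (ArchimedeanOrderedField.0# K) γ)
  (γ<1 : ArchimedeanOrderedField._<_ K γ (ArchimedeanOrderedField.1# K))
  where

  open ArchimedeanOrderedField K
  open Probability K
  open Butterflies _≟ᴸ_ _≟ᴿ_
  open ButterflyCounts _≟ᴸ_ _≟ᴿ_
  open FLEET1 K _≟ᴸ_ _≟ᴿ_ M γ γ>0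
  open State
  open OrderedFieldProperties K
  open FiniteSums K
  open Expectation K
  open SublistSums K {Edge}
  open Loop K _≟ᴸ_ _≟ᴿ_ M 5≤M γ γ>0 γ<1
  open Arrivals K _≟ᴸ_ _≟ᴿ_ M 5≤M γ γ>0 γ<1
  open Weight
  open ≼-Reasoning

  private
    variable
      a b : Level

  indicator : {P : Set a} → Dec P → Carrier
  indicator (yes _) = 1#
  indicator (no _)  = 0#

  0≼indicator : {P : Set a} (d : Dec P) → 0# ≼ indicator d
  0≼indicator (yes _) = 0≼1
  0≼indicator (no _)  = ≼-refl

  indicator-no : {P : Set a} (d : Dec P) → ¬ P → indicator d ≈ 0#
  indicator-no (yes x) ¬x = contradiction x ¬x
  indicator-no (no _)  ¬x = refl

  indicator-⇔ : {P : Set a} {Q : Set b} (d : Dec P) (d′ : Dec Q) → (P → Q) → (Q → P) → indicator d ≈ indicator d′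
  indicator-⇔ (yes x) (yes y) f g = refl
  indicator-⇔ (yes x) (no ¬y) f g = contradiction (f x) ¬y
  indicator-⇔ (no ¬x) (yes y) f g = contradiction (g y) ¬x
  indicator-⇔ (no ¬x) (no ¬y) f g = refl

  fromℕ-length-filter : {A : Set} {P : Pred A a} (P? : Decidable P) → ∀ xs →
                        fromℕ (length (filter P? xs)) ≈ sumOver (indicator ∘ P?) xs
  fromℕ-length-filter P? []       = refl
  fromℕ-length-filter P? (x ∷ xs) with P? x
  ... | yes _ = +-congˡ (fromℕ-length-filter P? xs)
  ... | no _  = trans (fromℕ-length-filter P? xs) (sym (+-identityˡ _))

  butterflyWeight : Weight
  butterflyWeight .weight B     = indicator (isButterfly? B)
  butterflyWeight .0≼weight B   = 0≼indicator (isButterfly? B)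
  butterflyWeight .vanishes B 5≤|B| = indicator-no (isButterfly? B)
    (λ butterfly → ℕ.<-irrefl ≡.refl (≡.subst (5 ≤_) (isButterfly⇒length≡4 butterfly) 5≤|B|))
  butterflyWeight .invariant {B} {B′} B↭B′ = indicator-⇔ (isButterfly? B) (isButterfly? B′)
    (isButterfly-resp-↭ B↭B′) (isButterfly-resp-↭ (↭-sym B↭B′))

  indicator[_] : List Edge → Carrier
  indicator[ [] ]    = 1#
  indicator[ _ ∷ _ ] = 0#

  -- Its final potential is the constant 1, so its martingale measures the total mass of the halting
  -- executions.
  emptyWeight : Weight
  emptyWeight .weight                             = indicator[_]
  emptyWeight .0≼weight []                        = 0≼1
  emptyWeight .0≼weight (_ ∷ _)                   = ≼-refl
  emptyWeight .vanishes (_ ∷ _) _                 = refl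
  emptyWeight .invariant {[]}    {[]}    _        = refl
  emptyWeight .invariant {[]}    {_ ∷ _} []↭x∷xs  = contradiction (↭-sym []↭x∷xs) ¬x∷xs↭[]
  emptyWeight .invariant {_ ∷ _} {[]}    x∷xs↭[]  = contradiction x∷xs↭[] ¬x∷xs↭[]
  emptyWeight .invariant {_ ∷ _} {_ ∷ _} _        = refl

  sublistSum-[] : ∀ g → (∀ e B → g (e ∷ B) ≈ 0#) → ∀ G → sublistSum g G ≈ g []
  sublistSum-[] g g≈0 []      = +-identityʳ (g [])
  sublistSum-[] g g≈0 (e ∷ G) = begin-equality
    sublistSum g (e ∷ G)                         ≈⟨ sublistSum-∷ g e G ⟩
    sublistSum (g ∘ (e ∷_)) G + sublistSum g G   ≈⟨ +-cong (sum-zero (g≈0 e) (sublists G)) (sublistSum-[] g g≈0 G) ⟩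
    0# + g []                                    ≈⟨ +-identityˡ (g []) ⟩
    g []                                         ∎

  module Mass  = Martingale emptyWeight
  module Count = Martingale butterflyWeight

  1≈Φ : ∀ s → 1# ≈ Mass.Φ [] s
  1≈Φ s = sym (begin-equality
    Mass.Φ [] s          ≈⟨ sublistSum-[] _ (λ e B → trans (*-congˡ (+-identityʳ 0#)) (zeroʳ _)) (𝓡 s) ⟩
    1# * (1# + 0#)       ≈⟨ trans (*-identityˡ _) (+-identityʳ 1#) ⟩
    1#                   ∎)

  -- A butterfly has four edges, so the uniform factor `q ^ 4` in `β` is its own factor
  -- `q ^ length B`; for every other `B` both sides vanish.
  β≈Φ : ∀ {T s} → Invariant T [] s → β s ≈ Count.Φ [] s
  β≈Φ {s = s} I = begin-equality
    β s                                                   ≈⟨ Invariant.estimate I ⟩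
    q ^ 4 * fromℕ (ξ (𝓡 s))                               ≈⟨ *-congˡ (fromℕ-length-filter isButterfly? (sublists (𝓡 s))) ⟩
    q ^ 4 * sublistSum (indicator ∘ isButterfly?) (𝓡 s)   ≈⟨ sum-*ˡ (q ^ 4) (indicator ∘ isButterfly?) (sublists (𝓡 s)) ⟨
    sublistSum (λ B → q ^ 4 * indicator (isButterfly? B)) (𝓡 s)
                                                          ≈⟨ sublistSum-cong (λ B → term B (isButterfly? B)) (𝓡 s) ⟩
    Count.Φ [] s                                          ∎
    where
    q = p⁻¹ s

    extended-[] : ∀ B → Count.extended [] B ≈ indicator (isButterfly? B)
    extended-[] B = trans (+-identityʳ _) (reflexive (≡.cong (indicator ∘ isButterfly?) (List.++-identityʳ B)))

    term : ∀ B → (d : Dec (IsButterfly B)) → q ^ 4 * indicator (isButterfly? B) ≈ q ^ length B * Count.extended [] B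
    term B (yes butterfly) = trans
      (reflexive (≡.cong (λ k → q ^ k * indicator (isButterfly? B)) (≡.sym (isButterfly⇒length≡4 butterfly))))
      (*-congˡ (sym (extended-[] B)))
    term B (no ¬butterfly) = trans (trans (*-congˡ ≈0) (zeroʳ _)) (sym (trans (*-congˡ (trans (extended-[] B) ≈0)) (zeroʳ _)))
      where
      ≈0 : indicator (isButterfly? B) ≈ 0#
      ≈0 = indicator-no (isButterfly? B) ¬butterfly

  hasSum-resp-≈ : {A : Set} {F : A → Carrier} {μ ν : Carrier} → μ ≈ ν → HasSum F μ → HasSum F ν
  hasSum-resp-≈ μ≈ν F-sum ε 0<ε =
    proj₁ (F-sum ε 0<ε) , λ ys ys! xs⊆ys → let above , below = proj₂ (F-sum ε 0<ε) ys ys! xs⊆ys in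
      <-respˡ-≈ (+-congʳ μ≈ν) above , <-respʳ-≈ (+-congʳ μ≈ν) below

  -- `Mass` with the constant function 1 shows that the probabilities sum to one, that is, almost
  -- sure termination; `Count` with the identity gives the mean.
  estimator-expectation : ∀ es → Unique es →
    HasExpectation (process es initial >>= λ s → return (β s)) (fromℕ (ξ es))
  estimator-expectation es es! =
      hasSum-resp-≈ (sublistSum-[] indicator[_] (λ _ _ → refl) es)
        (Mass.hasSum-process es es! β (λ _ → 1#) _ (λ ω → sym (*-identityʳ _)) (λ {s} _ → 1≈Φ s))
    , hasSum-resp-≈ (sym (fromℕ-length-filter isButterfly? (sublists es)))
        (Count.hasSum-process es es! β id _ (λ ω → refl) β≈Φ)

lemma2 : ∀ {c ℓ₁ ℓ₂ ℓ₃} (K : ArchimedeanOrderedField c ℓ₁ ℓ₂ ℓ₃) →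
    let open ArchimedeanOrderedField K in
    let open Probability K in
    {L R : Set} (_≟ᴸ_ : DecidableEquality L) (_≟ᴿ_ : DecidableEquality R) →
    let open Butterflies _≟ᴸ_ _≟ᴿ_ in
    (M : ℕ) → 5 ≤ M →
    (γ : Carrier) (γ>0 : 0# < γ) → γ < 1# →
    (S : List (L × R)) → Unique S →
    (t : ℕ) → 1 ≤ t → t ≤ length S →
    HasExpectation (FLEET1.Y K _≟ᴸ_ _≟ᴿ_ M γ γ>0 S t) (fromℕ (ξ (take t S)))
lemma2 K _≟ᴸ_ _≟ᴿ_ M 5≤M γ γ>0 γ<1 S S! t _ _ =
  Unbiasedness.estimator-expectation K _≟ᴸ_ _≟ᴿ_ M 5≤M γ γ>0 γ<1 (take t S) (Unique.take⁺ t S!)
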